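{- There are a computable function $f$ and an algorithm that, given a finite simple connected undirected graph $G$ and a set $X\subseteq V(G)$ of size $d$ such that $G\setminus X$ is a threshold graph, runs in time $f(d)\cdot|V(G)|^{O(1)}$ and finds a conflict-free closed neighborhood coloring of $G$ with $k$ colors, for some $k$ satisfying $\chi_{cf}[G]\le k\le \chi_{cf}[G]+1$.
   Context: A threshold graph is a graph that can be constructed recursively (starting from a single vertex) by repeatedly adding an isolated vertex or a universal vertex (a vertex adjacent to all other current vertices). $G\setminus X$ is the graph obtained from $G$ by deleting the vertices of $X$. Let $N[v]$ be the closed neighborhood of $v$. For a coloring $C_G:V(G)\to\{1,\dots,k\}$ (not necessarily proper), a set $U\subseteq V(G)$ has a unique color if there is a color $c$ with $|\{u\in U: C_G(u)=c\}|=1$. The coloring is a conflict-free closed neighborhood (CF-CN) coloring if $N[v]$ has a unique color for every $v\in V(G)$. $\chi_{cf}[G]$ denotes the minimum number of colors in a CF-CN coloring of $G$. -}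

module Defs where

open import Data.Bool using (Bool; true; false; T)
open import Data.Fin using (Fin; toℕ)
open import Data.Fin.Properties using (_≟_)
open import Data.Fin.Subset using (Subset; ⁅_⁆; _∈_; _∉_; _∪_; _∩_; ∣_∣)
open import Data.List as List using (List; []; _∷_)
open import Data.Nat using (ℕ; zero; suc; _+_; _≤_)
open import Data.Product using (Σ-syntax; ∃-syntax; _×_)
open import Data.Vec as Vec using ()
open import Relation.Binary.Construct.Closure.ReflexiveTransitive using (Star)
open import Relation.Binary.PropositionalEquality using (_≡_)
open import Relation.Nullary using (¬_; does)

record Graph (n : ℕ) : Set where
  field
    adj    : Fin n → Fin n → Bool
    sym    : ∀ u v → adj u v ≡ adj v u
    irrefl : ∀ v → adj v v ≡ false

  Adj : Fin n → Fin n → Set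
  Adj u v = T (adj u v)

  N[_] : Fin n → Subset n
  N[ v ] = ⁅ v ⁆ ∪ Vec.tabulate (adj v)

open Graph public

Connected : ∀ {n} → Graph n → Set
Connected G = ∀ u v → Star (Adj G) u v

-- `Threshold G S`: the subgraph of G induced by S is a threshold graph.
-- The construction starts from one vertex, so S is never empty.
data Threshold {n} (G : Graph n) : Subset n → Set where
  single    : ∀ v → Threshold G ⁅ v ⁆
  isolated  : ∀ {S} v → Threshold G S → v ∉ S →
              (∀ u → u ∈ S → ¬ Adj G v u) → Threshold G (⁅ v ⁆ ∪ S)
  universal : ∀ {S} v → Threshold G S → v ∉ S →
              (∀ u → u ∈ S → Adj G v u) → Threshold G (⁅ v ⁆ ∪ S)

Coloring : ℕ → ℕ → Set
Coloring n k = Fin n → Fin k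

colorClass : ∀ {n k} → Coloring n k → Fin k → Subset n
colorClass C c = Vec.tabulate (λ u → does (C u ≟ c))

HasUniqueColor : ∀ {n k} → Coloring n k → Subset n → Set
HasUniqueColor C U = ∃[ c ] ∣ U ∩ colorClass C c ∣ ≡ 1

IsCFCN : ∀ {n k} → Graph n → Coloring n k → Set
IsCFCN G C = ∀ v → HasUniqueColor C (N[_] G v)

CFCNColorable : ∀ {n} → Graph n → ℕ → Set
CFCNColorable {n} G k = Σ[ C ∈ Coloring n k ] IsCFCN G C

χcf[_]≡_ : ∀ {n} → Graph n → ℕ → Set
χcf[ G ]≡ m = CFCNColorable G m × (∀ k → CFCNColorable G k → m ≤ k)

-- The machine model is a point-free form of Jones's WHILE language
-- (Computability and Complexity from a Programming Perspective, 1997).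
-- Programs act on binary trees, and every executed operation costs one step.
-- Each operation takes constant time on trees stored as shared pointers, so
-- running times agree with those of Turing machines up to a polynomial.

data Tree : Set where
  nil  : Tree
  cons : Tree → Tree → Tree

-- The head and tail of nil are nil, as in WHILE.
head tail : Tree → Tree
head nil        = nil
head (cons x _) = x
tail nil        = nil
tail (cons _ y) = y

infixr 5 _⨾_

data Program : Set where
  skip `nil `hd `tl : Program
  `cons             : Program → Program → Program
  _⨾_               : Program → Program → Program
  if_then_else_     : Program → Program → Program → Program
  while_loop_       : Program → Program → Program

-- `p ∶ x ⇓ y ⟨ t ⟩`: on input x, p halts with output y after t steps.
-- As a test, nil counts as false and every other tree as true.
data _∶_⇓_⟨_⟩ : Program → Tree → Tree → ℕ → Set where
  skip : ∀ {x} → skip ∶ x ⇓ x ⟨ 1 ⟩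
  `nil : ∀ {x} → `nil ∶ x ⇓ nil ⟨ 1 ⟩
  `hd  : ∀ {x} → `hd ∶ x ⇓ head x ⟨ 1 ⟩
  `tl  : ∀ {x} → `tl ∶ x ⇓ tail x ⟨ 1 ⟩
  `cons : ∀ {p q x y z s t} →
    p ∶ x ⇓ y ⟨ s ⟩ → q ∶ x ⇓ z ⟨ t ⟩ →
    `cons p q ∶ x ⇓ cons y z ⟨ suc (s + t) ⟩
  _⨾_ : ∀ {p q x y z s t} →
    p ∶ x ⇓ y ⟨ s ⟩ → q ∶ y ⇓ z ⟨ t ⟩ →
    (p ⨾ q) ∶ x ⇓ z ⟨ suc (s + t) ⟩
  if-true : ∀ {b p q x u v y s t} →
    b ∶ x ⇓ cons u v ⟨ s ⟩ → p ∶ x ⇓ y ⟨ t ⟩ →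
    (if b then p else q) ∶ x ⇓ y ⟨ suc (s + t) ⟩
  if-false : ∀ {b p q x y s t} →
    b ∶ x ⇓ nil ⟨ s ⟩ → q ∶ x ⇓ y ⟨ t ⟩ →
    (if b then p else q) ∶ x ⇓ y ⟨ suc (s + t) ⟩
  while-stop : ∀ {b p x s} →
    b ∶ x ⇓ nil ⟨ s ⟩ →
    (while b loop p) ∶ x ⇓ x ⟨ suc s ⟩
  while-step : ∀ {b p x u v y z r s t} →
    b ∶ x ⇓ cons u v ⟨ r ⟩ → p ∶ x ⇓ y ⟨ s ⟩ →
    (while b loop p) ∶ y ⇓ z ⟨ t ⟩ →
    (while b loop p) ∶ x ⇓ z ⟨ suc (r + s + t) ⟩

encodeBool : Bool → Tree
encodeBool false = nil
encodeBool true  = cons nil nil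

encodeℕ : ℕ → Tree
encodeℕ zero    = nil
encodeℕ (suc n) = cons nil (encodeℕ n)

encodeList : ∀ {A : Set} → (A → Tree) → List A → Tree
encodeList enc []       = nil
encodeList enc (x ∷ xs) = cons (enc x) (encodeList enc xs)

encodeSubset : ∀ {n} → Subset n → Tree
encodeSubset X = encodeList encodeBool (Vec.toList X)

encodeGraph : ∀ {n} → Graph n → Tree
encodeGraph G =
  encodeList (encodeList encodeBool)
    (List.tabulate (λ u → List.tabulate (λ v → adj G u v)))

encodeColoring : ∀ {n k} → Coloring n k → Tree
encodeColoring C = encodeList encodeℕ (List.tabulate (λ v → toℕ (C v)))

Computable : (ℕ → ℕ) → Set
Computable f =
  ∃[ p ] ∀ d → ∃[ t ] p ∶ encodeℕ d ⇓ encodeℕ (f d) ⟨ t ⟩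

{-# OPTIONS --safe #-}

-- Write H for the threshold graph G∖X. Some vertex w of H is adjacent to every other vertex
-- of H that has a neighbor in H. Recoloring w with a new color 0 makes every vertex
-- of N[w] happy, at the price of one color. Any other vertex v of H has all its neighbors in X,
-- so whether v is happy depends on the colors of v and of X only.
--
-- So for q = 1, 2, … and for every w, look for a coloring with w colored 0 and the colors 1, …, q
-- elsewhere. Color X first and then the rest, one vertex at a time, and keep one partial
-- coloring for each way the neighborhoods of X can look: which color each x ∈ X has, and, for each
-- color, whether it occurs never, once or more often in N[x]. There are at most 2^(3q|X|)
-- classes, and q = |X| + 1 always succeeds (distinct colors on X and one more for the other vertices).
--
-- Programs are compiled from a language whose only iteration is a fold over a list. The running
-- time is a polynomial, read off from the syntax, in the maximal length of these lists.
module Submission where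

open import Defs
open import Data.Bool as Bool using (Bool; T; false; true)
open import Data.Empty using (⊥-elim)
open import Data.Fin using (Fin; fromℕ<; suc; toℕ; zero)
open import Data.Fin.Properties as Fin using (toℕ-injective; toℕ<n)
open import Data.Fin.Subset as Subset using (Subset; ⁅_⁆; ∁; ∣_∣)
import Data.Fin.Subset.Properties as Subset
open import Data.List as List using (List; []; _∷_; allFin; foldl; length; map; reverse; tabulate)
import Data.List.Membership.DecPropositional as DecMembership
open import Data.List.Membership.Propositional using (_∈_; _∉_; find; lose)
import Data.List.Membership.Propositional.Properties as List
import Data.List.Membership.Setoid.Properties as SetoidMembership
import Data.List.Properties as List
open import Data.List.Relation.Unary.All as All using (All; []; _∷_)
import Data.List.Relation.Unary.All.Properties as All
open import Data.List.Relation.Unary.AllPairs as AllPairs using (AllPairs; []; _∷_)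
import Data.List.Relation.Unary.AllPairs.Properties as AllPairs
open import Data.List.Relation.Unary.Any as Any using (Any; here; there)
open import Data.List.Relation.Unary.Any.Properties as Any using (¬Any[])
import Data.List.Relation.Unary.Unique.Propositional.Properties as Unique
open import Data.Maybe using (Maybe; just; nothing)
open import Data.Nat using (>-nonZero⁻¹; NonZero; _*_; _+_; _<_; _^_; _∸_; _≤_; suc; s≤s; zero; z≤n; ℕ)
import Data.Nat.Properties as ℕ
open import Data.Nat.Solver using (module +-*-Solver)
open import Data.Product using (_,_; _×_; proj₁; proj₂; Σ-syntax; ∃-syntax)
open import Data.Sum as Sum using (_⊎_; inj₁; inj₂)
open import Data.Vec as Vec using (Vec; []; _∷_; lookup)
open import Data.Vec.Functional as F using (updateAt)
open import Data.Vec.Functional.Properties using (updateAt-minimal; updateAt-updates)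
import Data.Vec.Properties as Vec
open import Function using (Equivalence; _⇔_; _∘_; const; mk⇔)
open import Function.Construct.Composition using (_⇔-∘_)
open import Function.Construct.Identity using (⇔-id)
open import Function.Construct.Symmetry using (⇔-sym)
open import Relation.Binary.PropositionalEquality as ≡ using (_≡_; _≢_; cong; refl; subst)
open import Relation.Nullary using (Dec; T?; _×-dec_; _→-dec_; _⊎-dec_; does; no; yes; ¬?; ¬_)

-- A fold language and its compilation

-- Merging classes is sound because of the order. When a vertex outside X and `N[w]` receives its
-- color, all its neighbors have theirs, so it is judged on the spot. The only neighborhoods that
-- can still change and still matter are those of X, and for these the counts never, once, more
-- often are closed under coloring one more vertex. The algorithm does not recognize threshold
-- graphs: it tries every vertex as `w`, and the size of the tables must be bounded for wrong
-- choices too. Hence boundedness and distinctness of the entries are proved outright, while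
-- happiness of the vertices already colored and completeness are stated under the assumption that
-- `w` is a center. A final check of the whole coloring makes every reported success correct. The
-- tables are lists that programs fold over, so the number of classes enters the running time
-- through the length bound M. With M of the form n · g(d), a polynomial in M splits into f(d) ·
-- n^e.

data Exp (n : ℕ) : Set where
  var              : Fin n → Exp n
  nilᵉ             : Exp n
  consᵉ            : Exp n → Exp n → Exp n
  hdᵉ tlᵉ          : Exp n → Exp n
  ifᵉ              : Exp n → Exp n → Exp n → Exp n
  call             : ∀ {k} → Exp k → Vec (Exp n) k → Exp n
  -- In the body, variable 0 is the current element and variable 1 the accumulator.
  fold             : Exp n → Exp n → Exp (suc (suc n)) → Exp n

len : Tree → ℕ
len nil        = 0
len (cons _ y) = suc (len y)

-- M bounds the lengths of the lists that are folded over, on which alone the running time depends.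
module Evaluation (M : ℕ) where
  infix 4 _⊢_⇓_ _⊢_⇓*_

  data _⊢_⇓_ {n : ℕ} (ρ : Vec Tree n) : Exp n → Tree → Set
  data _⊢_⇓*_ {n : ℕ} (ρ : Vec Tree n) : ∀ {k} → Vec (Exp n) k → Vec Tree k → Set
  data Loop {n : ℕ} (ρ : Vec Tree n) (b : Exp (suc (suc n))) : Tree → Tree → Tree → Set

  data _⊢_⇓_ {n} ρ where
    var      : ∀ i → ρ ⊢ var i ⇓ lookup ρ i
    nilᵉ     : ρ ⊢ nilᵉ ⇓ nil
    consᵉ    : ∀ {d e x y} → ρ ⊢ d ⇓ x → ρ ⊢ e ⇓ y → ρ ⊢ consᵉ d e ⇓ cons x y
    hdᵉ      : ∀ {e x} → ρ ⊢ e ⇓ x → ρ ⊢ hdᵉ e ⇓ head x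
    tlᵉ      : ∀ {e x} → ρ ⊢ e ⇓ x → ρ ⊢ tlᵉ e ⇓ tail x
    if-true  : ∀ {b d e u v x} → ρ ⊢ b ⇓ cons u v → ρ ⊢ d ⇓ x → ρ ⊢ ifᵉ b d e ⇓ x
    if-false : ∀ {b d e x} → ρ ⊢ b ⇓ nil → ρ ⊢ e ⇓ x → ρ ⊢ ifᵉ b d e ⇓ x
    call     : ∀ {k} {e : Exp k} {es σ x} → ρ ⊢ es ⇓* σ → σ ⊢ e ⇓ x → ρ ⊢ call e es ⇓ x
    fold     : ∀ {a l b s xs x} → ρ ⊢ a ⇓ s → ρ ⊢ l ⇓ xs → len xs ≤ M →
               Loop ρ b s xs x → ρ ⊢ fold a l b ⇓ x

  data _⊢_⇓*_ {n} ρ where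
    []  : ρ ⊢ [] ⇓* []
    _∷_ : ∀ {k e x} {es : Vec (Exp n) k} {σ} → ρ ⊢ e ⇓ x → ρ ⊢ es ⇓* σ → ρ ⊢ e ∷ es ⇓* x ∷ σ

  data Loop {n} ρ b where
    stop : ∀ {s} → Loop ρ b s nil s
    step : ∀ {s s′ x xs y} → (x ∷ s ∷ ρ) ⊢ b ⇓ s′ → Loop ρ b s′ xs y → Loop ρ b s (cons x xs) y

encodeEnv : ∀ {n} → Vec Tree n → Tree
encodeEnv []      = nil
encodeEnv (x ∷ ρ) = cons x (encodeEnv ρ)

compileVar : ∀ {n} → Fin n → Program
compileVar zero    = `hd
compileVar (suc i) = `tl ⨾ compileVar i

-- A loop runs on cons xs (cons s ρ), with xs the rest of the list and s the accumulator.
loopBody : Program → Program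
loopBody b = `cons (`hd ⨾ `tl) (`cons (`cons (`hd ⨾ `hd) `tl ⨾ b) (`tl ⨾ `tl))

compile : ∀ {n} → Exp n → Program
compile* : ∀ {n k} → Vec (Exp n) k → Program
compile (var i)      = compileVar i
compile nilᵉ         = `nil
compile (consᵉ d e)  = `cons (compile d) (compile e)
compile (hdᵉ e)      = compile e ⨾ `hd
compile (tlᵉ e)      = compile e ⨾ `tl
compile (ifᵉ b d e)  = if compile b then compile d else compile e
compile (call e es)  = compile* es ⨾ compile e
compile (fold a l b) = `cons (compile l) (`cons (compile a) skip)
                     ⨾ (while `hd loop loopBody (compile b)) ⨾ `tl ⨾ `hd
compile* []       = `nil
compile* (e ∷ es) = `cons (compile e) (compile* es)

boundVar : ∀ {n} → Fin n → ℕ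
boundVar zero    = 1
boundVar (suc i) = 2 + boundVar i

-- A conditional is charged for both branches and a fold for `suc M` rounds, so the bound depends on
-- the syntax and on M only; the extra round pays for the failing test that ends the loop. The
-- constants 8 and 16 count the bookkeeping around a loop and within one round.
bound : ∀ {n} → Exp n → ℕ → ℕ
bound* : ∀ {n k} → Vec (Exp n) k → ℕ → ℕ
bound (var i)      M = boundVar i
bound nilᵉ         M = 1
bound (consᵉ d e)  M = 1 + (bound d M + bound e M)
bound (hdᵉ e)      M = 1 + (bound e M + 1)
bound (tlᵉ e)      M = 1 + (bound e M + 1)
bound (ifᵉ b d e)  M = 1 + (bound b M + (bound d M + bound e M))
bound (call e es)  M = 1 + (bound* es M + bound e M)
bound (fold a l b) M = (8 + (bound l M + bound a M)) + suc M * (16 + bound b M)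
bound* []       M = 1
bound* (e ∷ es) M = 1 + (bound e M + bound* es M)

-- Polynomial bounds for the cost of expressions

Poly : (ℕ → ℕ) → Set
Poly B = ∃[ c ] ∃[ d ] ∀ M → B M ≤ c * suc M ^ d

poly-const : ∀ c → Poly (λ _ → c)
poly-const c = c , 0 , λ _ → ℕ.≤-reflexive (≡.sym (ℕ.*-identityʳ c))

poly-suc : Poly suc
poly-suc = 1 , 1 , λ M → ℕ.≤-reflexive (solve 1 (λ m → con 1 :+ m := con 1 :* ((con 1 :+ m) :* con 1)) refl M)
  where open +-*-Solver

poly-+ : ∀ {A B} → Poly A → Poly B → Poly (λ M → A M + B M)
poly-+ {A} {B} (c , d , p) (c′ , d′ , p′) = c + c′ , d + d′ , λ M → begin
  A M + B M                                       ≤⟨ ℕ.+-mono-≤ (p M) (p′ M) ⟩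
  c * suc M ^ d + c′ * suc M ^ d′                 ≤⟨ ℕ.+-mono-≤
     (ℕ.*-monoʳ-≤ c (ℕ.^-monoʳ-≤ (suc M) (ℕ.m≤m+n d d′)))
     (ℕ.*-monoʳ-≤ c′ (ℕ.^-monoʳ-≤ (suc M) (ℕ.m≤n+m d′ d))) ⟩
  c * suc M ^ (d + d′) + c′ * suc M ^ (d + d′)    ≡⟨ ℕ.*-distribʳ-+ (suc M ^ (d + d′)) c c′ ⟨
  (c + c′) * suc M ^ (d + d′)                     ∎
  where open ℕ.≤-Reasoning

poly-* : ∀ {A B} → Poly A → Poly B → Poly (λ M → A M * B M)
poly-* {A} {B} (c , d , p) (c′ , d′ , p′) = c * c′ , d + d′ , λ M → begin
  A M * B M                               ≤⟨ ℕ.*-mono-≤ (p M) (p′ M) ⟩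
  (c * suc M ^ d) * (c′ * suc M ^ d′)     ≡⟨ ℕ.[m*n]*[o*p]≡[m*o]*[n*p] c (suc M ^ d) c′ (suc M ^ d′) ⟩
  (c * c′) * (suc M ^ d * suc M ^ d′)     ≡⟨ cong (c * c′ *_) (ℕ.^-distribˡ-+-* (suc M) d d′) ⟨
  (c * c′) * suc M ^ (d + d′)             ∎
  where open ℕ.≤-Reasoning

bound-poly : ∀ {n} (e : Exp n) → Poly (bound e)
bound*-poly : ∀ {n k} (es : Vec (Exp n) k) → Poly (bound* es)
bound-poly (var i)      = poly-const (boundVar i)
bound-poly nilᵉ         = poly-const 1
bound-poly (consᵉ d e)  = poly-+ (poly-const 1) (poly-+ (bound-poly d) (bound-poly e))
bound-poly (hdᵉ e)      = poly-+ (poly-const 1) (poly-+ (bound-poly e) (poly-const 1))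
bound-poly (tlᵉ e)      = poly-+ (poly-const 1) (poly-+ (bound-poly e) (poly-const 1))
bound-poly (ifᵉ b d e)  = poly-+ (poly-const 1) (poly-+ (bound-poly b) (poly-+ (bound-poly d) (bound-poly e)))
bound-poly (call e es)  = poly-+ (poly-const 1) (poly-+ (bound*-poly es) (bound-poly e))
bound-poly (fold a l b) =
  poly-+ (poly-+ (poly-const 8) (poly-+ (bound-poly l) (bound-poly a)))
         (poly-* poly-suc (poly-+ (poly-const 16) (bound-poly b)))
bound*-poly []       = poly-const 1
bound*-poly (e ∷ es) = poly-+ (poly-const 1) (poly-+ (bound-poly e) (bound*-poly es))

infix 4 _∶_⇓_within_

_∶_⇓_within_ : Program → Tree → Tree → ℕ → Set
p ∶ x ⇓ y within b = ∃[ t ] p ∶ x ⇓ y ⟨ t ⟩ × t ≤ b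

module Compilation (M : ℕ) where
  open Evaluation M

  compileVar-correct : ∀ {n} (ρ : Vec Tree n) i →
    compileVar i ∶ encodeEnv ρ ⇓ lookup ρ i within boundVar i
  compileVar-correct (x ∷ ρ) zero    = 1 , `hd , ℕ.≤-refl
  compileVar-correct (x ∷ ρ) (suc i) with t , r , t≤ ← compileVar-correct ρ i =
    2 + t , `tl ⨾ r , s≤s (s≤s t≤)

  compile-correct : ∀ {n} {ρ : Vec Tree n} {e x} → ρ ⊢ e ⇓ x →
    compile e ∶ encodeEnv ρ ⇓ x within bound e M
  compile*-correct : ∀ {n k} {ρ : Vec Tree n} {es : Vec (Exp n) k} {σ} → ρ ⊢ es ⇓* σ →
    compile* es ∶ encodeEnv ρ ⇓ encodeEnv σ within bound* es M
  loop-correct : ∀ {n} {ρ : Vec Tree n} {b s xs y} → Loop ρ b s xs y →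
    (while `hd loop loopBody (compile b)) ∶ cons xs (cons s (encodeEnv ρ))
      ⇓ cons nil (cons y (encodeEnv ρ)) within suc (len xs) * (16 + bound b M)

  compile-correct (var i) = compileVar-correct _ i
  compile-correct nilᵉ = 1 , `nil , ℕ.≤-refl
  compile-correct (consᵉ d e)
    with _ , r , ≤r ← compile-correct d | _ , s , ≤s ← compile-correct e =
    _ , `cons r s , s≤s (ℕ.+-mono-≤ ≤r ≤s)
  compile-correct (hdᵉ e) with _ , r , ≤r ← compile-correct e =
    _ , r ⨾ `hd , s≤s (ℕ.+-monoˡ-≤ 1 ≤r)
  compile-correct (tlᵉ e) with _ , r , ≤r ← compile-correct e =
    _ , r ⨾ `tl , s≤s (ℕ.+-monoˡ-≤ 1 ≤r)
  compile-correct (if-true b d)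
    with _ , r , ≤r ← compile-correct b | _ , s , ≤s ← compile-correct d =
    _ , if-true r s , s≤s (ℕ.+-mono-≤ ≤r (ℕ.m≤n⇒m≤n+o _ ≤s))
  compile-correct (if-false b e)
    with _ , r , ≤r ← compile-correct b | _ , s , ≤s ← compile-correct e =
    _ , if-false r s , s≤s (ℕ.+-mono-≤ ≤r (ℕ.m≤n⇒m≤o+n _ ≤s))
  compile-correct (call es e)
    with _ , r , ≤r ← compile*-correct es | _ , s , ≤s ← compile-correct e =
    _ , r ⨾ s , s≤s (ℕ.+-mono-≤ ≤r ≤s)
  compile-correct (fold {a} {l} {b} {xs = xs} ea el short es)
    with s , ra , ≤a ← compile-correct ea | t , rl , ≤l ← compile-correct el
       | u , r , ≤u ← loop-correct es =
    _ , `cons rl (`cons ra skip) ⨾ r ⨾ `tl ⨾ `hd , (begin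
      suc (suc (t + suc (s + 1)) + suc (u + 3))
        ≡⟨ solve 3 (λ s t u → con 1 :+ (con 1 :+ (t :+ (con 1 :+ (s :+ con 1))) :+ (con 1 :+ (u :+ con 3)))
             := (con 8 :+ (t :+ s)) :+ u) refl s t u ⟩
      8 + (t + s) + u
        ≤⟨ ℕ.+-mono-≤ (ℕ.+-monoʳ-≤ 8 (ℕ.+-mono-≤ ≤l ≤a))
             (ℕ.≤-trans ≤u (ℕ.*-monoˡ-≤ (16 + bound b M) (s≤s short))) ⟩
      bound (fold a l b) M ∎)
    where
    open ℕ.≤-Reasoning
    open +-*-Solver

  compile*-correct [] = 1 , `nil , ℕ.≤-refl
  compile*-correct (e ∷ es)
    with _ , r , ≤r ← compile-correct e | _ , s , ≤s ← compile*-correct es =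
    _ , `cons r s , s≤s (ℕ.+-mono-≤ ≤r ≤s)

  loop-correct stop = 2 , while-stop `hd , s≤s (s≤s z≤n)
  loop-correct {b = b} (step {xs = xs} e es)
    with s , r , ≤s ← compile-correct e | t , r′ , ≤t ← loop-correct es =
    _ , while-step `hd (`cons (`hd ⨾ `tl) (`cons (`cons (`hd ⨾ `hd) `tl ⨾ r) (`tl ⨾ `tl))) r′ ,
    (begin
      suc (1 + suc (3 + suc (suc (5 + s) + 3)) + t)
        ≡⟨ solve 2 (λ s t → con 1 :+ (con 1 :+ (con 1 :+ (con 3 :+ (con 1 :+ (con 1 :+ (con 5 :+ s) :+ con 3)))) :+ t)
              := (con 16 :+ s) :+ t) refl s t ⟩
      16 + s + t
        ≤⟨ ℕ.+-mono-≤ (ℕ.+-monoʳ-≤ 16 ≤s) ≤t ⟩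
      suc (suc (len xs)) * (16 + bound b M) ∎)
    where
    open ℕ.≤-Reasoning
    open +-*-Solver

-- Derived operations

pattern x₀ = var zero
pattern x₁ = var (suc zero)
pattern x₂ = var (suc (suc zero))
pattern x₃ = var (suc (suc (suc zero)))
pattern x₄ = var (suc (suc (suc (suc zero))))
pattern x₅ = var (suc (suc (suc (suc (suc zero)))))
pattern x₆ = var (suc (suc (suc (suc (suc (suc zero))))))
pattern x₇ = var (suc (suc (suc (suc (suc (suc (suc zero)))))))

private variable
  n : ℕ

trueᵉ : Exp n
trueᵉ = consᵉ nilᵉ nilᵉ

andᵉ orᵉ impᵉ iffᵉ : Exp n → Exp n → Exp n
andᵉ d e = ifᵉ d e nilᵉ
orᵉ d e  = ifᵉ d trueᵉ e
impᵉ d e = ifᵉ d e trueᵉ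
iffᵉ d e = ifᵉ d e (ifᵉ e nilᵉ trueᵉ)

anyᵉ allᵉ firstᵉ : Exp n → Exp (suc (suc n)) → Exp n
anyᵉ l b   = fold nilᵉ l (ifᵉ x₁ trueᵉ b)
allᵉ l b   = fold trueᵉ l (ifᵉ x₁ b nilᵉ)
firstᵉ l b = fold nilᵉ l (ifᵉ x₁ x₁ b)

-- On a unary number d this is subtraction, on a list d it drops the first i entries.
dropᵉ : Exp n → Exp n → Exp n
dropᵉ d i = fold d i (tlᵉ x₁)

nthᵉ eqᵉ : Exp n → Exp n → Exp n
nthᵉ l i = hdᵉ (dropᵉ l i)
eqᵉ d e  = ifᵉ (dropᵉ d e) nilᵉ (ifᵉ (dropᵉ e d) nilᵉ trueᵉ)

len-encodeList : ∀ {A : Set} (enc : A → Tree) xs → len (encodeList enc xs) ≡ length xs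
len-encodeList enc []       = refl
len-encodeList enc (x ∷ xs) = cong suc (len-encodeList enc xs)

len-encodeℕ : ∀ m → len (encodeℕ m) ≡ m
len-encodeℕ zero    = refl
len-encodeℕ (suc m) = cong suc (len-encodeℕ m)

length-allFin : ∀ n → length (allFin n) ≡ n
length-allFin n = List.length-tabulate (λ u → u)

encodeFin : Fin n → Tree
encodeFin = encodeℕ ∘ toℕ

encodeMaybe : ∀ {S : Set} → (S → Tree) → Maybe S → Tree
encodeMaybe enc nothing  = nil
encodeMaybe enc (just s) = enc s

Outcome : ∀ {S : Set} → Set → (S → Set) → Maybe S → Set
Outcome F A nothing  = F
Outcome F A (just s) = A s

-- Specifications of the derived operations

module Combinators (M : ℕ) where
  open Evaluation M

  infix 4 _⊢_⇓?_

  -- The counterpart of `Dec` for programs: a run to a truth value with the matching proof or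
  -- refutation. Truth is always the tree `cons nil nil`, so results can be kept as encoded
  -- Booleans.
  data _⊢_⇓?_ (ρ : Vec Tree n) (e : Exp n) (A : Set) : Set where
    holds : ρ ⊢ e ⇓ cons nil nil → A → ρ ⊢ e ⇓? A
    fails  : ρ ⊢ e ⇓ nil → ¬ A → ρ ⊢ e ⇓? A

  private variable
    ρ : Vec Tree n
    d e l : Exp n
    A B : Set

  map? : A ⇔ B → ρ ⊢ e ⇓? A → ρ ⊢ e ⇓? B
  map? A⇔B (holds r a) = holds r (Equivalence.to A⇔B a)
  map? A⇔B (fails r ¬a) = fails r (¬a ∘ Equivalence.from A⇔B)

  call? : ∀ {k} {b : Exp k} {es σ} → ρ ⊢ es ⇓* σ → σ ⊢ b ⇓? A → ρ ⊢ call b es ⇓? A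
  call? rs (holds r a) = holds (call rs r) a
  call? rs (fails r ¬a) = fails (call rs r) ¬a

  true-⇓ : ρ ⊢ trueᵉ ⇓ cons nil nil
  true-⇓ = consᵉ nilᵉ nilᵉ

  and? : ρ ⊢ d ⇓? A → ρ ⊢ e ⇓? B → ρ ⊢ andᵉ d e ⇓? (A × B)
  and? (holds r a) (holds s b) = holds (if-true r s) (a , b)
  and? (holds r a) (fails s ¬b) = fails (if-true r s) λ (_ , b) → ¬b b
  and? (fails r ¬a) _         = fails (if-false r nilᵉ) λ (a , _) → ¬a a

  or? : ρ ⊢ d ⇓? A → ρ ⊢ e ⇓? B → ρ ⊢ orᵉ d e ⇓? (A ⊎ B)
  or? (holds r a) _         = holds (if-true r true-⇓) (inj₁ a)
  or? (fails r ¬a) (holds s b) = holds (if-false r s) (inj₂ b)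
  or? (fails r ¬a) (fails s ¬b) = fails (if-false r s) λ { (inj₁ a) → ¬a a ; (inj₂ b) → ¬b b }

  imp? : ρ ⊢ d ⇓? A → ρ ⊢ e ⇓? B → ρ ⊢ impᵉ d e ⇓? (A → B)
  imp? (holds r a) (holds s b) = holds (if-true r s) λ _ → b
  imp? (holds r a) (fails s ¬b) = fails (if-true r s) λ f → ¬b (f a)
  imp? (fails r ¬a) _         = holds (if-false r true-⇓) λ a → ⊥-elim (¬a a)

  iff? : ρ ⊢ d ⇓? A → ρ ⊢ e ⇓? B → ρ ⊢ iffᵉ d e ⇓? (A ⇔ B)
  iff? (holds r a) (holds s b) = holds (if-true r s) (mk⇔ (λ _ → b) (λ _ → a))
  iff? (holds r a) (fails s ¬b) = fails (if-true r s) λ f → ¬b (Equivalence.to f a)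
  iff? (fails r ¬a) (holds s b) = fails (if-false r (if-true s nilᵉ)) λ f → ¬a (Equivalence.from f b)
  iff? (fails r ¬a) (fails s ¬b) =
    holds (if-false r (if-false s true-⇓)) (mk⇔ (λ a → ⊥-elim (¬a a)) (λ b → ⊥-elim (¬b b)))

  if-cons : ∀ {b y t u x} → ρ ⊢ b ⇓ y → y ≡ cons t u → ρ ⊢ d ⇓ x → ρ ⊢ ifᵉ b d e ⇓ x
  if-cons r refl r′ = if-true r r′

  if-invariant : ∀ {S : Set} (encS : S → Tree) {I : S → Set} {b} → ρ ⊢ b ⇓? A →
    (A → ∃[ s ] ρ ⊢ d ⇓ encS s × I s) → (¬ A → ∃[ s ] ρ ⊢ e ⇓ encS s × I s) →
    ∃[ s ] ρ ⊢ ifᵉ b d e ⇓ encS s × I s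
  if-invariant encS (holds r a) f g = let s , r′ , i = f a in s , if-true r r′ , i
  if-invariant encS (fails r ¬a) f g = let s , r′ , i = g ¬a in s , if-false r r′ , i

  -- `I` relates the state to the entries still to be read, so a run ends at `I []`. The body learns
  -- that its entry belongs to the whole list, which is how bounds on colors or table entries reach
  -- it.
  fold-invariant : ∀ {X S : Set} (enc : X → Tree) (encS : S → Tree) (I : List X → S → Set) {xs s₀ a b} →
    ρ ⊢ a ⇓ encS s₀ → ρ ⊢ l ⇓ encodeList enc xs → length xs ≤ M → I xs s₀ →
    (∀ {x ys s} → x ∈ xs → I (x ∷ ys) s →
      ∃[ s′ ] (enc x ∷ encS s ∷ ρ) ⊢ b ⇓ encS s′ × I ys s′) →
    ∃[ s ] ρ ⊢ fold a l b ⇓ encS s × I [] s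
  fold-invariant {ρ = ρ} {X = X} enc encS I {xs} {b = b} ra rl short i body =
    let s , r , j = run xs (λ x∈ → x∈) i
    in s , fold ra rl (ℕ.≤-trans (ℕ.≤-reflexive (len-encodeList enc xs)) short) r , j
    where
    run : ∀ ys {s} → (∀ {y} → y ∈ ys → y ∈ xs) → I ys s →
          ∃[ s′ ] Loop ρ b (encS s) (encodeList enc ys) (encS s′) × I [] s′
    run [] {s} _ i = s , stop , i
    run (y ∷ ys) ⊆xs i =
      let s′ , r , j  = body (⊆xs (here refl)) i
          s″ , r′ , k = run ys (⊆xs ∘ there) j
      in s″ , step r r′ , k

  module _ {X : Set} (enc : X → Tree) {A : X → Set} {xs b}
           (rl : ρ ⊢ l ⇓ encodeList enc xs) (short : length xs ≤ M)
           (body : ∀ {x s} → x ∈ xs → (enc x ∷ s ∷ ρ) ⊢ b ⇓? A x) where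

    any? : ρ ⊢ anyᵉ l b ⇓? Any A xs
    any? with fold-invariant enc encodeBool
               -- As long as no witness has been met, every witness lies among the entries to come;
               -- at the end of the list this refutes `Any A xs`.
               (λ ys s → (s ≡ true × Any A xs) ⊎ (s ≡ false × (Any A xs → Any A ys)))
               nilᵉ rl short (inj₂ (refl , λ p → p)) next
      where
      next : ∀ {x ys s} → x ∈ xs →
        (s ≡ true × Any A xs) ⊎ (s ≡ false × (Any A xs → Any A (x ∷ ys))) → _
      next x∈ (inj₁ (refl , p)) = true , if-true (var _) true-⇓ , inj₁ (refl , p)
      next x∈ (inj₂ (refl , p)) with body x∈
      ... | holds r a = true , if-false (var _) r , inj₁ (refl , lose x∈ a)
      ... | fails r ¬a = false , if-false (var _) r ,
                      inj₂ (refl , λ q → Any.tail ¬a (p q))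
    ... | true , r , inj₁ (refl , p)  = holds r p
    ... | false , r , inj₂ (refl , p) = fails r (λ q → ¬Any[] (p q))

    all? : ρ ⊢ allᵉ l b ⇓? All A xs
    all? with fold-invariant enc encodeBool
               (λ ys s → (s ≡ true × (All A ys → All A xs)) ⊎ (s ≡ false × (¬ All A xs)))
               true-⇓ rl short (inj₁ (refl , λ p → p)) next
      where
      next : ∀ {x ys s} → x ∈ xs →
        (s ≡ true × (All A (x ∷ ys) → All A xs)) ⊎ (s ≡ false × (¬ All A xs)) → _
      next x∈ (inj₂ (refl , p)) = false , if-false (var _) nilᵉ , inj₂ (refl , p)
      next x∈ (inj₁ (refl , p)) with body x∈
      ... | holds r a = true , if-true (var _) r , inj₁ (refl , λ q → p (a ∷ q))
      ... | fails r ¬a = false , if-true (var _) r , inj₂ (refl , λ q → ¬a (All.lookup q x∈))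
    ... | true , r , inj₁ (refl , p)  = holds r (p [])
    ... | false , r , inj₂ (refl , p) = fails r p

  module _ {X S : Set} (enc : X → Tree) (encS : S → Tree) (nonempty : ∀ s → ∃[ t ] ∃[ u ] encS s ≡ cons t u)
           {A : S → Set} {F : X → Set} {xs b}
           (rl : ρ ⊢ l ⇓ encodeList enc xs) (short : length xs ≤ M)
           (body : ∀ {x s} → x ∈ xs →
             ∃[ r ] (enc x ∷ s ∷ ρ) ⊢ b ⇓ encodeMaybe encS r × Outcome (F x) A r) where

    first-⇓ : ∃[ r ] ρ ⊢ firstᵉ l b ⇓ encodeMaybe encS r × Outcome (∀ {x} → x ∈ xs → F x) A r
    first-⇓ =
      let r , run , i = fold-invariant enc (encodeMaybe encS)
            -- Before a success, each entry is either still to come or known to fail.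
            (λ ys → Outcome (∀ {x} → x ∈ xs → x ∈ ys ⊎ F x) A) {s₀ = nothing}
            nilᵉ rl short inj₁ (λ {_} {_} {s} x∈ i → next s x∈ i)
      in r , run , finish r i
      where
      next : ∀ {x ys} s → x ∈ xs → Outcome (∀ {y} → y ∈ xs → y ∈ x ∷ ys ⊎ F y) A s →
        ∃[ s′ ] (enc x ∷ encodeMaybe encS s ∷ ρ) ⊢ ifᵉ x₁ x₁ b ⇓ encodeMaybe encS s′ ×
                Outcome (∀ {y} → y ∈ xs → y ∈ ys ⊎ F y) A s′
      next (just s) x∈ a =
        let _ , _ , eq = nonempty s
        in just s , if-cons (var _) eq (var _) , a
      next {x} {ys} nothing x∈ i with body x∈
      ... | just s , run , a  = just s , if-false (var _) run , a
      ... | nothing , run , f = nothing , if-false (var _) run , λ y∈ → rest (i y∈)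
        where
        rest : ∀ {y} → y ∈ x ∷ ys ⊎ F y → y ∈ ys ⊎ F y
        rest (inj₁ (here refl)) = inj₂ f
        rest (inj₁ (there y∈))  = inj₁ y∈
        rest (inj₂ g)           = inj₂ g
      finish : ∀ r → Outcome (∀ {x} → x ∈ xs → x ∈ [] ⊎ F x) A r → Outcome (∀ {x} → x ∈ xs → F x) A r
      finish (just _) a = a
      finish nothing f x∈ with inj₂ g ← f x∈ = g

  drop-⇓ : ∀ {m k} → ρ ⊢ d ⇓ encodeℕ m → ρ ⊢ e ⇓ encodeℕ k → k ≤ M →
           ρ ⊢ dropᵉ d e ⇓ encodeℕ (m ∸ k)
  drop-⇓ {k = k} rd re k≤ = fold rd re (ℕ.≤-trans (ℕ.≤-reflexive (len-encodeℕ k)) k≤) (run _ k)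
    where
    run : ∀ m k → Loop _ (tlᵉ x₁) (encodeℕ m) (encodeℕ k) (encodeℕ (m ∸ k))
    run m       zero    = stop
    run zero    (suc k) = step (tlᵉ (var _))
      (subst (Loop _ _ nil (encodeℕ k)) (cong encodeℕ (ℕ.0∸n≡0 k)) (run zero k))
    run (suc m) (suc k) = step (tlᵉ (var _)) (run m k)

  -- Two truncated subtractions, each a fold over one of the numbers; hence both numbers have to
  -- obey the length bound.
  eq? : ∀ {m k} → ρ ⊢ d ⇓ encodeℕ m → ρ ⊢ e ⇓ encodeℕ k → m ≤ M → k ≤ M →
        ρ ⊢ eqᵉ d e ⇓? (m ≡ k)
  eq? {m = m} {k} rd re m≤ k≤
    with m ∸ k in p | drop-⇓ rd re k≤ | k ∸ m in q | drop-⇓ re rd m≤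
  ... | zero  | r | zero  | s =
    holds (if-false r (if-false s true-⇓)) (ℕ.≤-antisym (ℕ.m∸n≡0⇒m≤n p) (ℕ.m∸n≡0⇒m≤n q))
  ... | zero  | r | suc _ | s = fails (if-false r (if-true s nilᵉ))
    λ { refl → ℕ.0≢1+n (≡.trans (≡.sym (ℕ.n∸n≡0 m)) q) }
  ... | suc _ | r | _     | _ = fails (if-true r nilᵉ)
    λ { refl → ℕ.0≢1+n (≡.trans (≡.sym (ℕ.n∸n≡0 m)) p) }

  eqFin? : ∀ {N} {u v : Fin N} → N ≤ M → ρ ⊢ d ⇓ encodeFin u → ρ ⊢ e ⇓ encodeFin v →
           ρ ⊢ eqᵉ d e ⇓? (u ≡ v)
  eqFin? {u = u} {v} N≤ rd re =
    map? (mk⇔ toℕ-injective (cong toℕ))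
      (eq? rd re (ℕ.≤-trans (ℕ.<⇒≤ (toℕ<n u)) N≤) (ℕ.≤-trans (ℕ.<⇒≤ (toℕ<n v)) N≤))

  nth-⇓ : ∀ {N} {X : Set} (enc : X → Tree) {f : Fin N → X} {i} → N ≤ M →
          ρ ⊢ l ⇓ encodeList enc (tabulate f) → ρ ⊢ e ⇓ encodeFin i → ρ ⊢ nthᵉ l e ⇓ enc (f i)
  nth-⇓ {ρ = ρ} {l} {e} enc {f} {i} N≤ rl re =
    let t , r , eq = run f i in
    subst (ρ ⊢ nthᵉ l e ⇓_) eq
      (hdᵉ (fold rl re (ℕ.≤-trans (ℕ.≤-reflexive (len-encodeℕ (toℕ i)))
                         (ℕ.≤-trans (ℕ.<⇒≤ (toℕ<n i)) N≤)) r))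
    where
    run : ∀ {N} (f : Fin N → _) i →
          ∃[ t ] Loop ρ (tlᵉ x₁) (encodeList enc (tabulate f)) (encodeFin i) t × head t ≡ enc (f i)
    run f zero    = _ , stop , refl
    run f (suc i) = let t , r , eq = run (f ∘ suc) i in t , step (tlᵉ (var _)) r , eq

  bool? : ∀ {b} → ρ ⊢ e ⇓ encodeBool b → ρ ⊢ e ⇓? T b
  bool? {b = true}  r = holds r _
  bool? {b = false} r = fails r λ ()

  tabulate-⇓ : ∀ {N} {X : Set} (enc : X → Tree) {f : Fin N → X} {b} → N ≤ M →
    ρ ⊢ l ⇓ encodeList encodeFin (reverse (allFin N)) →
    (∀ {u s} → (encodeFin u ∷ s ∷ ρ) ⊢ b ⇓ enc (f u)) →
    ρ ⊢ fold nilᵉ l (consᵉ b x₁) ⇓ encodeList enc (tabulate f)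
  tabulate-⇓ {ρ = ρ} {l} {N} enc {f} {b} N≤ rl rb
    with fold-invariant encodeFin (encodeList enc)
           (λ ys s → foldl (λ s y → f y ∷ s) s ys ≡ tabulate f)
           nilᵉ rl
           (ℕ.≤-trans (ℕ.≤-reflexive (≡.trans (List.length-reverse (allFin N)) (length-allFin N))) N≤)
           (≡.trans (List.reverse-foldl _ [] (allFin N))
             (≡.trans (foldr-map (allFin N)) (List.map-tabulate (λ u → u) f)))
           (λ {x} {s = s} _ eq → f x ∷ s , consᵉ rb (var _) , eq)
    where
    foldr-map : ∀ us → List.foldr (λ y s → f y ∷ s) [] us ≡ map f us
    foldr-map []       = refl
    foldr-map (u ∷ us) = cong (f u ∷_) (foldr-map us)
  ... | _ , r , refl = r

private variable
  k : ℕ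

-- The dynamic program

-- The argument g of the programs below is the instance (G , V , X , colors , w). The comment above
-- a program names its variables, from 0 on.
graphᵉ verticesᵉ specialᵉ colorsᵉ centerᵉ : Exp k → Exp k
graphᵉ g    = hdᵉ g
verticesᵉ g = hdᵉ (tlᵉ g)
specialᵉ g  = hdᵉ (tlᵉ (tlᵉ g))
colorsᵉ g   = hdᵉ (tlᵉ (tlᵉ (tlᵉ g)))
centerᵉ g   = tlᵉ (tlᵉ (tlᵉ (tlᵉ g)))

memᵉ : Exp k → Exp k → Exp k → Exp k
memᵉ g x u = orᵉ (eqᵉ x u) (nthᵉ (nthᵉ (graphᵉ g) x) u)

coloredᵉ : Exp k → Exp k → Exp k → Exp k → Exp k → Exp k
coloredᵉ g P x c u = andᵉ (memᵉ g x u) (eqᵉ (nthᵉ P u) c)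

opaque
  -- g, P, x, c
  someᵉ : Exp 4
  someᵉ = anyᵉ (verticesᵉ x₀) (coloredᵉ x₂ x₃ x₄ x₅ x₀)

opaque
  -- g, P, x, c
  uniqueᵉ : Exp 4
  uniqueᵉ = anyᵉ (verticesᵉ x₀) (andᵉ (coloredᵉ x₂ x₃ x₄ x₅ x₀)
              (allᵉ (verticesᵉ x₂) (impᵉ (coloredᵉ x₄ x₅ x₆ x₇ x₀) (eqᵉ x₂ x₀))))

opaque
  -- g, P, P′, x, c
  sameᵉ : Exp 5
  sameᵉ = andᵉ (iffᵉ (eqᵉ (nthᵉ x₁ x₃) x₄) (eqᵉ (nthᵉ x₂ x₃) x₄))
         (andᵉ (iffᵉ (call someᵉ (x₀ ∷ x₁ ∷ x₃ ∷ x₄ ∷ [])) (call someᵉ (x₀ ∷ x₂ ∷ x₃ ∷ x₄ ∷ [])))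
               (iffᵉ (call uniqueᵉ (x₀ ∷ x₁ ∷ x₃ ∷ x₄ ∷ [])) (call uniqueᵉ (x₀ ∷ x₂ ∷ x₃ ∷ x₄ ∷ []))))

opaque
  -- g, P, P′
  equivᵉ : Exp 3
  equivᵉ = allᵉ (specialᵉ x₀) (allᵉ (colorsᵉ x₂) (call sameᵉ (x₄ ∷ x₅ ∷ x₆ ∷ x₂ ∷ x₀ ∷ [])))

opaque
  -- g, the admissible colors, P, v
  happyᵉ : Exp 4
  happyᵉ = anyᵉ x₁ (call uniqueᵉ (x₂ ∷ x₄ ∷ x₅ ∷ x₀ ∷ []))

opaque
  -- g, P, v
  allowedᵉ : Exp 3
  allowedᵉ = orᵉ (anyᵉ (specialᵉ x₀) (eqᵉ x₀ x₄))
            (orᵉ (memᵉ x₀ (centerᵉ x₀) x₂) (call happyᵉ (x₀ ∷ colorsᵉ x₀ ∷ x₁ ∷ x₂ ∷ [])))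

opaque
  -- g, P, v, c
  updateᵉ : Exp 4
  updateᵉ = fold nilᵉ (verticesᵉ x₀) (consᵉ (ifᵉ (eqᵉ x₀ x₄) x₅ (nthᵉ x₃ x₀)) x₁)

opaque
  -- g, table, P
  insertᵉ : Exp 3
  insertᵉ = ifᵉ (anyᵉ x₁ (call equivᵉ (x₂ ∷ x₀ ∷ x₄ ∷ []))) x₁ (consᵉ x₂ x₁)

opaque
  -- g, table, P, v
  tryᵉ : Exp 4
  tryᵉ = ifᵉ (call allowedᵉ (x₀ ∷ x₂ ∷ x₃ ∷ [])) (call insertᵉ (x₀ ∷ x₁ ∷ x₂ ∷ [])) x₁

opaque
  -- g, table, P, v
  extendᵉ : Exp 4
  extendᵉ = fold x₁ (colorsᵉ x₀)
              (call tryᵉ (x₂ ∷ x₁ ∷ call updateᵉ (x₂ ∷ x₄ ∷ x₅ ∷ x₀ ∷ []) ∷ x₅ ∷ []))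

opaque
  -- g, table, v
  stepᵉ : Exp 3
  stepᵉ = ifᵉ (eqᵉ x₂ (centerᵉ x₀)) x₁ (fold nilᵉ x₁ (call extendᵉ (x₂ ∷ x₁ ∷ x₀ ∷ x₄ ∷ [])))

opaque
  -- g, the order in which to color, the uncolored P
  tableᵉ : Exp 3
  tableᵉ = fold (consᵉ x₂ nilᵉ) x₁ (call stepᵉ (x₂ ∷ x₁ ∷ x₀ ∷ []))

opaque
  -- g, P
  validᵉ : Exp 2
  validᵉ = allᵉ (verticesᵉ x₀) (call happyᵉ (x₂ ∷ consᵉ nilᵉ (colorsᵉ x₂) ∷ x₃ ∷ x₀ ∷ []))

opaque
  -- g, the order in which to color, the uncolored P
  trialᵉ : Exp 3
  trialᵉ = firstᵉ (call tableᵉ (x₀ ∷ x₁ ∷ x₂ ∷ [])) (ifᵉ (call validᵉ (x₂ ∷ x₀ ∷ [])) x₀ nilᵉ)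

-- Partial colorings and what X sees of them

colors : ℕ → List ℕ
colors zero    = []
colors (suc q) = suc q ∷ colors q

colors-≤ : ∀ {q c} → c ∈ colors q → c ≤ q
colors-≤ {suc q} (here refl) = ℕ.≤-refl
colors-≤ {suc q} (there c∈)  = ℕ.m≤n⇒m≤1+n (colors-≤ c∈)

colors-≢0 : ∀ {q c} → c ∈ colors q → c ≢ 0
colors-≢0 {suc q} (here refl) ()
colors-≢0 {suc q} (there c∈)  = colors-≢0 c∈

∈-colors : ∀ {q c} → c ≢ 0 → c ≤ q → c ∈ colors q
∈-colors {zero}  c≢0 z≤n = ⊥-elim (c≢0 refl)
∈-colors {suc q} c≢0 c≤ with ℕ.m≤n⇒m<n∨m≡n c≤
... | inj₁ (s≤s c≤q) = there (∈-colors c≢0 c≤q)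
... | inj₂ refl      = here refl

length-colors : ∀ q → length (colors q) ≡ q
length-colors zero    = refl
length-colors (suc q) = cong suc (length-colors q)

-- Decreasing, because a fold that conses reverses its list.
vertices : ∀ n → List (Fin n)
vertices n = reverse (allFin n)

∈-vertices : ∀ {n} (u : Fin n) → u ∈ vertices n
∈-vertices u = Any.reverse⁺ (List.∈-allFin u)

length-vertices : ∀ n → length (vertices n) ≡ n
length-vertices n = ≡.trans (List.length-reverse (allFin n)) (length-allFin n)

-- Color 0 marks the vertices that are not colored yet, and the center w.
PartialColoring : ℕ → Set
PartialColoring n = Fin n → ℕ

encodePartial : ∀ {n} → PartialColoring n → Tree
encodePartial P = encodeList encodeℕ (tabulate P)

_[_≔_] : ∀ {n} → PartialColoring n → Fin n → ℕ → PartialColoring n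
P [ v ≔ c ] = updateAt P v (const c)

module Neighborhoods {n : ℕ} (G : Graph n) where

  Mem : Fin n → Fin n → Set
  Mem x u = x ≡ u ⊎ Adj G x u

  Colored : PartialColoring n → Fin n → ℕ → Fin n → Set
  Colored P x c u = Mem x u × P u ≡ c

  Some Unique : PartialColoring n → Fin n → ℕ → Set
  Some P x c   = ∃[ u ] Colored P x c u
  Unique P x c = ∃[ u ] Colored P x c u × (∀ u′ → Colored P x c u′ → u ≡ u′)

  Happy : List ℕ → PartialColoring n → Fin n → Set
  Happy cs P v = Any (Unique P v) cs

module Tables {n : ℕ} (G : Graph n) (Xs : List (Fin n)) (q : ℕ) (w : Fin n) where
  open Neighborhoods G

  -- `Some` and `Unique` together give the number of vertices of color `c` in `N[x]`, truncated at
  -- two. The color of `x` itself is what neighbors of `x` outside X depend on. Only colors from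
  -- `colors q` are compared, since a vertex of color 0 may still change.
  Same : (P P′ : PartialColoring n) → Fin n → ℕ → Set
  Same P P′ x c = (P x ≡ c ⇔ P′ x ≡ c) × (Some P x c ⇔ Some P′ x c) × (Unique P x c ⇔ Unique P′ x c)

  -- What X sees of P, which determines what X will see of every extension of P.
  Equiv : (P P′ : PartialColoring n) → Set
  Equiv P P′ = All (λ x → All (Same P P′ x) (colors q)) Xs

  -- The test applied at the moment `v` is colored. A vertex of X passes, as its neighborhood may
  -- still be incomplete; a vertex of `N[w]` passes, as color 0 will serve it.
  Allowed : PartialColoring n → Fin n → Set
  Allowed P v = v ∈ Xs ⊎ Mem w v ⊎ Happy (colors q) P v

  Distinct : List (PartialColoring n) → Set
  Distinct = AllPairs (λ P P′ → ¬ Equiv P′ P)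

  Covered : List (PartialColoring n) → PartialColoring n → Set
  Covered L P = Any (λ P′ → Equiv P′ P) L

  Bounded : PartialColoring n → Set
  Bounded P = ∀ u → P u ≤ q

  instanceTree : Tree
  instanceTree = cons (encodeGraph G) (cons (encodeList encodeFin (vertices n))
    (cons (encodeList encodeFin Xs) (cons (encodeList encodeℕ (colors q)) (encodeFin w))))

  equiv-refl : ∀ {P} → Equiv P P
  equiv-refl = All.tabulate λ _ → All.tabulate λ _ → ⇔-id _ , ⇔-id _ , ⇔-id _

  module Specification (M : ℕ) (n≤M : n ≤ M) (Xs≤M : length Xs ≤ M) (q<M : suc q ≤ M) where
    open Evaluation M
    open Combinators M

    q≤M : q ≤ M
    q≤M = ℕ.≤-trans (ℕ.n≤1+n q) q<M

    private variable
      ρ : Vec Tree k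
      g P x c u v : Exp k

    vertices-⇓ : ρ ⊢ g ⇓ instanceTree → ρ ⊢ verticesᵉ g ⇓ encodeList encodeFin (vertices n)
    vertices-⇓ rg = hdᵉ (tlᵉ rg)

    special-⇓ : ρ ⊢ g ⇓ instanceTree → ρ ⊢ specialᵉ g ⇓ encodeList encodeFin Xs
    special-⇓ rg = hdᵉ (tlᵉ (tlᵉ rg))

    colors-⇓ : ρ ⊢ g ⇓ instanceTree → ρ ⊢ colorsᵉ g ⇓ encodeList encodeℕ (colors q)
    colors-⇓ rg = hdᵉ (tlᵉ (tlᵉ (tlᵉ rg)))

    vertices-short : length (vertices n) ≤ M
    vertices-short = ℕ.≤-trans (ℕ.≤-reflexive (length-vertices n)) n≤M

    colors-short : length (colors q) ≤ M
    colors-short = ℕ.≤-trans (ℕ.≤-reflexive (length-colors q)) q≤M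

    mem? : ∀ {y z} → ρ ⊢ g ⇓ instanceTree → ρ ⊢ x ⇓ encodeFin y → ρ ⊢ u ⇓ encodeFin z →
           ρ ⊢ memᵉ g x u ⇓? Mem y z
    mem? rg rx ru = or? (eqFin? n≤M rx ru)
      (bool? (nth-⇓ encodeBool n≤M (nth-⇓ (encodeList encodeBool) n≤M (hdᵉ rg) rx) ru))

    color? : ∀ {Q y a} → Bounded Q → a ≤ q → ρ ⊢ P ⇓ encodePartial Q →
      ρ ⊢ x ⇓ encodeFin y → ρ ⊢ c ⇓ encodeℕ a → ρ ⊢ eqᵉ (nthᵉ P x) c ⇓? (Q y ≡ a)
    color? bQ a≤ rP rx rc =
      eq? (nth-⇓ encodeℕ n≤M rP rx) rc (ℕ.≤-trans (bQ _) q≤M) (ℕ.≤-trans a≤ q≤M)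

    colored? : ∀ {Q y a z} → Bounded Q → a ≤ q → ρ ⊢ g ⇓ instanceTree → ρ ⊢ P ⇓ encodePartial Q →
      ρ ⊢ x ⇓ encodeFin y → ρ ⊢ c ⇓ encodeℕ a → ρ ⊢ u ⇓ encodeFin z →
      ρ ⊢ coloredᵉ g P x c u ⇓? Colored Q y a z
    colored? bQ a≤ rg rP rx rc ru =
      and? (mem? rg rx ru) (color? bQ a≤ rP ru rc)

    anyVertex? : ∀ {A : Fin n → Set} {b} → ρ ⊢ g ⇓ instanceTree →
      (∀ {u s} → (encodeFin u ∷ s ∷ ρ) ⊢ b ⇓? A u) → ρ ⊢ anyᵉ (verticesᵉ g) b ⇓? (∃[ u ] A u)
    anyVertex? rg rb = map? (mk⇔ (λ p → let u , _ , a = find p in u , a) (λ (u , a) → lose (∈-vertices u) a))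
      (any? encodeFin (vertices-⇓ rg) vertices-short (λ _ → rb))

    allVertices? : ∀ {A : Fin n → Set} {b} → ρ ⊢ g ⇓ instanceTree →
      (∀ {u s} → (encodeFin u ∷ s ∷ ρ) ⊢ b ⇓? A u) → ρ ⊢ allᵉ (verticesᵉ g) b ⇓? (∀ u → A u)
    allVertices? rg rb = map? (mk⇔ (λ p u → All.lookup p (∈-vertices u)) (λ a → All.tabulate (λ {u} _ → a u)))
      (all? encodeFin (vertices-⇓ rg) vertices-short (λ _ → rb))

    opaque
      unfolding someᵉ

      some? : ∀ {Q y a} → Bounded Q → a ≤ q →
        (instanceTree ∷ encodePartial Q ∷ encodeFin y ∷ encodeℕ a ∷ []) ⊢ someᵉ ⇓? Some Q y a
      some? bQ a≤ = anyVertex? (var _) (colored? bQ a≤ (var _) (var _) (var _) (var _) (var _))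

    opaque
      unfolding uniqueᵉ

      unique? : ∀ {Q y a} → Bounded Q → a ≤ q →
        (instanceTree ∷ encodePartial Q ∷ encodeFin y ∷ encodeℕ a ∷ []) ⊢ uniqueᵉ ⇓? Unique Q y a
      unique? bQ a≤ = anyVertex? (var _)
        (and? (colored? bQ a≤ (var _) (var _) (var _) (var _) (var _))
              (allVertices? (var _) (imp? (colored? bQ a≤ (var _) (var _) (var _) (var _) (var _))
                                          (eqFin? n≤M (var _) (var _)))))

    opaque
      unfolding sameᵉ

      same? : ∀ {Q Q′ y a} → Bounded Q → Bounded Q′ → a ≤ q →
        (instanceTree ∷ encodePartial Q ∷ encodePartial Q′ ∷ encodeFin y ∷ encodeℕ a ∷ []) ⊢ sameᵉ ⇓? Same Q Q′ y a
      same? {Q} {Q′} bQ bQ′ a≤ =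
        and? (iff? (color? bQ a≤ (var _) (var _) (var _)) (color? bQ′ a≤ (var _) (var _) (var _)))
        (and? (iff? (call? (var _ ∷ var _ ∷ var _ ∷ var _ ∷ []) (some? bQ a≤))
                    (call? (var _ ∷ var _ ∷ var _ ∷ var _ ∷ []) (some? bQ′ a≤)))
              (iff? (call? (var _ ∷ var _ ∷ var _ ∷ var _ ∷ []) (unique? bQ a≤))
                    (call? (var _ ∷ var _ ∷ var _ ∷ var _ ∷ []) (unique? bQ′ a≤))))

    opaque
      unfolding equivᵉ

      equiv? : ∀ {Q Q′} → Bounded Q → Bounded Q′ →
        (instanceTree ∷ encodePartial Q ∷ encodePartial Q′ ∷ []) ⊢ equivᵉ ⇓? Equiv Q Q′
      equiv? bQ bQ′ = all? encodeFin (special-⇓ (var _)) Xs≤M λ _ →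
        all? encodeℕ (colors-⇓ (var _)) colors-short λ a∈ →
        call? (var _ ∷ var _ ∷ var _ ∷ var _ ∷ var _ ∷ []) (same? bQ bQ′ (colors-≤ a∈))

    opaque
      unfolding happyᵉ

      happy? : ∀ {cs Q y} → length cs ≤ M → (∀ {a} → a ∈ cs → a ≤ q) → Bounded Q →
        (instanceTree ∷ encodeList encodeℕ cs ∷ encodePartial Q ∷ encodeFin y ∷ []) ⊢ happyᵉ ⇓? Happy cs Q y
      happy? short cs≤ bQ = any? encodeℕ (var _) short λ a∈ →
        call? (var _ ∷ var _ ∷ var _ ∷ var _ ∷ []) (unique? bQ (cs≤ a∈))

    opaque
      unfolding allowedᵉ

      allowed? : ∀ {Q y} → Bounded Q →
        (instanceTree ∷ encodePartial Q ∷ encodeFin y ∷ []) ⊢ allowedᵉ ⇓? Allowed Q y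
      allowed? bQ = or?
        (map? (mk⇔ (Any.map ≡.sym) (Any.map ≡.sym))
          (any? encodeFin (special-⇓ (var _)) Xs≤M λ _ → eqFin? n≤M (var _) (var _)))
        (or? (mem? (var _) (tlᵉ (tlᵉ (tlᵉ (tlᵉ (var _))))) (var _))
             (call? (var _ ∷ colors-⇓ (var _) ∷ var _ ∷ var _ ∷ []) (happy? colors-short colors-≤ bQ)))

    ⇓-≡ : ∀ {e : Exp k} {a b} → a ≡ b → ρ ⊢ e ⇓ encodeℕ a → ρ ⊢ e ⇓ encodeℕ b
    ⇓-≡ refl r = r

    opaque
      unfolding updateᵉ

      update-⇓ : ∀ {Q : PartialColoring n} {y : Fin n} {a} →
        (instanceTree ∷ encodePartial Q ∷ encodeFin y ∷ encodeℕ a ∷ []) ⊢ updateᵉ ⇓ encodePartial (Q [ y ≔ a ])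
      update-⇓ {Q} {y} {a} =
        tabulate-⇓ encodeℕ n≤M (vertices-⇓ (var _)) (entry (eqFin? n≤M (var _) (var _)))
        where
        entry : ∀ {z : Fin n} {s} (let ρ = encodeFin z ∷ s ∷ instanceTree ∷ encodePartial Q ∷ encodeFin y ∷ encodeℕ a ∷ []) →
                ρ ⊢ eqᵉ x₀ x₄ ⇓? (z ≡ y) → ρ ⊢ ifᵉ (eqᵉ x₀ x₄) x₅ (nthᵉ x₃ x₀) ⇓ encodeℕ ((Q [ y ≔ a ]) z)
        entry {z} (holds r refl) =
          ⇓-≡ (≡.sym (updateAt-updates z {f = const a} Q)) (if-true r (var _))
        entry {z} (fails r z≢y) =
          ⇓-≡ (≡.sym (updateAt-minimal z y {f = const a} Q z≢y))
            (if-false r (nth-⇓ encodeℕ n≤M (var _) (var _)))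

    update-bounded : ∀ {Q y a} → Bounded Q → a ≤ q → Bounded (Q [ y ≔ a ])
    update-bounded {Q} {y} {a} bQ a≤ z with z Fin.≟ y
    ... | yes refl rewrite updateAt-updates z {f = const a} Q = a≤
    ... | no z≢y rewrite updateAt-minimal z y {f = const a} Q z≢y = bQ z

    encodeTable : List (PartialColoring n) → Tree
    encodeTable = encodeList encodePartial

    module Growth (short : ∀ {L} → Distinct L → length L ≤ M)
                  (Good : PartialColoring n → Set) (bounded : ∀ {Q} → Good Q → Bounded Q) where

      Table : List (PartialColoring n) → Set
      Table L = All Good L × Distinct L

      _⊑_ : (L L′ : List (PartialColoring n)) → Set
      L ⊑ L′ = ∀ R → Covered L R → Covered L′ R

      opaque
        unfolding insertᵉ

        -- Looking for an equivalent entry is a fold over the table itself, which is where the bound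
        -- on the number of classes enters the running time.
        insert-⇓ : ∀ {L Q} → Table L → Good Q →
          ∃[ L′ ] (instanceTree ∷ encodeTable L ∷ encodePartial Q ∷ []) ⊢ insertᵉ ⇓ encodeTable L′ ×
                  Table L′ × L ⊑ L′ × Covered L′ Q
        insert-⇓ {L} {Q} (good , distinct) good-Q =
          if-invariant encodeTable
            (any? encodePartial {A = λ P → Equiv P Q} {xs = L} (var _) (short distinct)
               (λ P∈ → call? (var _ ∷ var _ ∷ var _ ∷ []) (equiv? (bounded (All.lookup good P∈)) (bounded good-Q))))
            (λ cover → L , var _ , (good , distinct) , (λ _ p → p) , cover)
            (λ ¬cover → Q ∷ L , consᵉ (var _) (var _) ,
              (good-Q ∷ good , All.tabulate (λ P∈ e → ¬cover (lose P∈ e)) ∷ distinct) , (λ _ → there) , here equiv-refl)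

      opaque
        unfolding tryᵉ

        try-⇓ : ∀ {L Q y} → Table L → Bounded Q → (Allowed Q y → Good Q) →
          ∃[ L′ ] (instanceTree ∷ encodeTable L ∷ encodePartial Q ∷ encodeFin y ∷ []) ⊢ tryᵉ ⇓ encodeTable L′ ×
                  Table L′ × L ⊑ L′ × (Allowed Q y → Covered L′ Q)
        try-⇓ {L} {Q} table bQ good =
          if-invariant encodeTable (call? (var _ ∷ var _ ∷ var _ ∷ []) (allowed? bQ))
            (λ p → let L′ , r , table′ , keep , cover = insert-⇓ table (good p)
                   in L′ , call (var _ ∷ var _ ∷ var _ ∷ []) r , table′ , keep , λ _ → cover)
            (λ ¬p → L , var _ , table , (λ _ p → p) , λ p → ⊥-elim (¬p p))

      Extends : Fin n → List (PartialColoring n) → List (PartialColoring n) → PartialColoring n → Set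
      Extends y L L′ Q = Table L′ × L ⊑ L′ ×
        (∀ a → a ∈ colors q → Allowed (Q [ y ≔ a ]) y → Covered L′ (Q [ y ≔ a ]))

      opaque
        unfolding extendᵉ

        extend-⇓ : ∀ {L Q y} → Table L → Bounded Q →
          (∀ a → a ∈ colors q → Allowed (Q [ y ≔ a ]) y → Good (Q [ y ≔ a ])) →
          ∃[ L′ ] (instanceTree ∷ encodeTable L ∷ encodePartial Q ∷ encodeFin y ∷ []) ⊢ extendᵉ ⇓ encodeTable L′ ×
                  Extends y L L′ Q
        extend-⇓ {L} {Q} {y} table bQ good =
          let L′ , r , table′ , keep , covers =
                fold-invariant encodeℕ encodeTable
                 (λ cs L′ → Table L′ × L ⊑ L′ ×
                    (∀ a → a ∈ colors q → Allowed (Q [ y ≔ a ]) y → a ∈ cs ⊎ Covered L′ (Q [ y ≔ a ])))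
                 (var _) (colors-⇓ (var _)) colors-short
                 (table , (λ _ p → p) , λ _ a∈ _ → inj₁ a∈)
                 (λ a∈ (table′ , keep , covers) →
                   let L″ , r , table″ , keep′ , cover =
                         try-⇓ table′ (update-bounded {y = y} bQ (colors-≤ a∈)) (good _ a∈)
                   in L″ , call (var _ ∷ var _ ∷ call (var _ ∷ var _ ∷ var _ ∷ var _ ∷ []) update-⇓ ∷ var _ ∷ []) r ,
                      table″ , (λ R p → keep′ R (keep R p)) ,
                      λ b b∈ allowed → next cover keep′ allowed (covers b b∈ allowed))
          in L′ , r , table′ , keep , λ a a∈ allowed → Sum.[ (λ ()) , (λ p → p) ]′ (covers a a∈ allowed)
          where
          next : ∀ {a b cs L₁ L₂} → (Allowed (Q [ y ≔ a ]) y → Covered L₂ (Q [ y ≔ a ])) →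
            L₁ ⊑ L₂ → Allowed (Q [ y ≔ b ]) y →
            b ∈ a ∷ cs ⊎ Covered L₁ (Q [ y ≔ b ]) → b ∈ cs ⊎ Covered L₂ (Q [ y ≔ b ])
          next cover _ allowed (inj₁ (here refl)) = inj₂ (cover allowed)
          next _ _     allowed (inj₁ (there b∈))  = inj₁ b∈
          next _ keep′ allowed (inj₂ covered)     = inj₂ (keep′ _ covered)

      -- The new table is built from the empty one: the entries of `L` leave `y` uncolored and are
      -- only read.
      extendAll-⇓ : ∀ {L y} → All Bounded L → length L ≤ M →
        (∀ Q a → Q ∈ L → a ∈ colors q → Allowed (Q [ y ≔ a ]) y → Good (Q [ y ≔ a ])) →
        ∃[ L′ ] (instanceTree ∷ encodeTable L ∷ encodeFin y ∷ []) ⊢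
                  fold nilᵉ x₁ (call extendᵉ (x₂ ∷ x₁ ∷ x₀ ∷ x₄ ∷ [])) ⇓ encodeTable L′ × Table L′ ×
                (∀ Q a → Q ∈ L → a ∈ colors q → Allowed (Q [ y ≔ a ]) y → Covered L′ (Q [ y ≔ a ]))
      extendAll-⇓ {L} {y} bL short-L good =
        let L′ , r , table′ , covers =
              fold-invariant encodePartial encodeTable
               (λ Qs L′ → Table L′ ×
                  (∀ Q a → Q ∈ L → a ∈ colors q → Allowed (Q [ y ≔ a ]) y → Q ∈ Qs ⊎ Covered L′ (Q [ y ≔ a ])))
               {xs = L} {s₀ = []} nilᵉ (var _) short-L
               (([] , []) , λ _ _ Q∈ _ _ → inj₁ Q∈)
               (λ Q∈ (table′ , covers) →
                 let L″ , r , table″ , keep , cover = extend-⇓ table′ (All.lookup bL Q∈) (λ a → good _ a Q∈)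
                 in L″ , call (var _ ∷ var _ ∷ var _ ∷ var _ ∷ []) r , table″ ,
                    λ R a R∈ a∈ allowed → next cover keep a∈ allowed (covers R a R∈ a∈ allowed))
        in L′ , r , table′ , λ Q a Q∈ a∈ allowed → Sum.[ (λ ()) , (λ p → p) ]′ (covers Q a Q∈ a∈ allowed)
        where
        next : ∀ {P Q Qs L₁ L₂ a} →
          (∀ a → a ∈ colors q → Allowed (P [ y ≔ a ]) y → Covered L₂ (P [ y ≔ a ])) →
          L₁ ⊑ L₂ → a ∈ colors q → Allowed (Q [ y ≔ a ]) y →
          Q ∈ P ∷ Qs ⊎ Covered L₁ (Q [ y ≔ a ]) → Q ∈ Qs ⊎ Covered L₂ (Q [ y ≔ a ])
        next cover _ a∈ allowed (inj₁ (here refl)) = inj₂ (cover _ a∈ allowed)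
        next _ _     a∈ allowed (inj₁ (there Q∈))  = inj₁ Q∈
        next _ keep  a∈ allowed (inj₂ covered)     = inj₂ (keep _ covered)

-- Correctness of the dynamic program

≡-⇔ : ∀ {a b c : ℕ} → a ≡ b → a ≡ c ⇔ b ≡ c
≡-⇔ refl = ⇔-id _

module Updates {n : ℕ} (G : Graph n) where
  open Neighborhoods G

  mem? : ∀ x u → Dec (Mem x u)
  mem? x u = x Fin.≟ u ⊎-dec T? (adj G x u)

  updated : ∀ (P : PartialColoring n) (v : Fin n) {a} → (P [ v ≔ a ]) v ≡ a
  updated P v {a} = updateAt-updates v {f = const a} P

  unchanged : ∀ (P : PartialColoring n) (v : Fin n) {a u} → u ≢ v → (P [ v ≔ a ]) u ≡ P u
  unchanged P v {a} u≢v = updateAt-minimal _ v {f = const a} P u≢v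

  unique-cong : ∀ {P P′ x c} → (∀ {u} → Mem x u → P u ≡ c ⇔ P′ u ≡ c) → Unique P x c → Unique P′ x c
  unique-cong same (u , (m , p) , only) =
    u , (m , Equivalence.to (same m) p) , λ u′ (m′ , p′) → only u′ (m′ , Equivalence.from (same m′) p′)

  mem-sym : ∀ {x u} → Mem x u → Mem u x
  mem-sym (inj₁ p) = inj₁ (≡.sym p)
  mem-sym {x} {u} (inj₂ p) = inj₂ (subst T (Graph.sym G x u) p)

  module _ {P : PartialColoring n} {v : Fin n} (Pv≡0 : P v ≡ 0) {a : ℕ} {x : Fin n} {c : ℕ} (c≢0 : c ≢ 0) where

    colored-≢ : ∀ {u} → Colored P x c u → u ≢ v
    colored-≢ (_ , p) refl = c≢0 (≡.trans (≡.sym p) Pv≡0)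

    colored-update : ∀ {u} → Colored P x c u → Colored (P [ v ≔ a ]) x c u
    colored-update q@(m , p) = m , ≡.trans (unchanged P v (colored-≢ q)) p

  colored-new : ∀ {P v a x c} → Mem x v → a ≡ c → Colored (P [ v ≔ a ]) x c v
  colored-new {P} {v} m p = m , ≡.trans (updated P v) p

  data ColoredUpdate (P : PartialColoring n) (v : Fin n) (a : ℕ) (x : Fin n) (c : ℕ) : Fin n → Set where
    new : Mem x v → a ≡ c → ColoredUpdate P v a x c v
    old : ∀ {u} → u ≢ v → Colored P x c u → ColoredUpdate P v a x c u

  colored-view : ∀ {P v a x c u} → Colored (P [ v ≔ a ]) x c u → ColoredUpdate P v a x c u
  colored-view {P} {v} {u = u} (m , p) with u Fin.≟ v
  ... | yes refl = new m (≡.trans (≡.sym (updated P v)) p)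
  ... | no u≢v   = old u≢v (m , ≡.trans (≡.sym (unchanged P v u≢v)) p)

  module _ {P P′ : PartialColoring n} {v : Fin n} (Pv≡0 : P v ≡ 0) (P′v≡0 : P′ v ≡ 0)
           {a : ℕ} {x : Fin n} {c : ℕ} (c≢0 : c ≢ 0) where

    some-update : (Some P x c → Some P′ x c) → Some (P [ v ≔ a ]) x c → Some (P′ [ v ≔ a ]) x c
    some-update f (u , q) with colored-view {P} q
    ... | new m p = v , colored-new {P′} m p
    ... | old _ q′ = let z , r = f (u , q′) in z , colored-update P′v≡0 c≢0 r

    -- If `v` becomes the only vertex of color `c`, a second one in `P′` would yield an old one in
    -- `P`, different from `v` because `v` was uncolored. Otherwise the unique vertex is an old one,
    -- and `v` cannot be a vertex of `N[x]` that gets color `c`.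
    unique-update : (Some P′ x c → Some P x c) → (Unique P x c → Unique P′ x c) →
                    Unique (P [ v ≔ a ]) x c → Unique (P′ [ v ≔ a ]) x c
    unique-update f g (u , q , only) with colored-view {P} q
    ... | new m p = v , colored-new {P′} m p , only′
      where
      only′ : ∀ z → Colored (P′ [ v ≔ a ]) x c z → v ≡ z
      only′ z r with colored-view {P′} r
      ... | new _ _  = refl
      ... | old _ r′ = let y , s = f (z , r′) in
        ⊥-elim (colored-≢ Pv≡0 {a = a} c≢0 s (≡.sym (only y (colored-update Pv≡0 c≢0 s))))
    ... | old u≢v q′ = let z , r , only″ = g (u , q′ , λ y s → only y (colored-update Pv≡0 c≢0 s)) in
      z , colored-update P′v≡0 c≢0 r , only′ only″
      where
      only′ : ∀ {z} → (∀ y → Colored P′ x c y → z ≡ y) → ∀ y → Colored (P′ [ v ≔ a ]) x c y → z ≡ y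
      only′ only″ y s with colored-view {P′} s
      ... | new m p  = ⊥-elim (u≢v (only v (colored-new {P} m p)))
      ... | old _ s′ = only″ y s′

∉-∷ : ∀ {A : Set} {u v : A} {rest} → u ≢ v → u ∉ rest → u ∉ v ∷ rest
∉-∷ u≢v u∉ (here u≡v) = u≢v u≡v
∉-∷ u≢v u∉ (there u∈) = u∉ u∈

module TableInvariants {n : ℕ} (G : Graph n) (Xs : List (Fin n)) (q : ℕ) (w : Fin n) where
  open Neighborhoods G
  open Updates G
  open Tables G Xs q w
  open DecMembership (Fin._≟_ {n}) using (_∈?_)

  Center : Set
  Center = ∀ v u → v ∉ Xs → ¬ Mem w v → Adj G v u → u ∈ Xs

  -- Coloring v does not affect what u sees, unless u is bound to be happy for another reason.
  Settled : Fin n → Fin n → Set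
  Settled u v = u ∈ Xs ⊎ Mem w u ⊎ ¬ Mem u v

  Ordered : List (Fin n) → Set
  Ordered = AllPairs (λ u v → u ≢ v × (Center → Settled u v))

  Past : List (Fin n) → Set
  Past rest = ∀ u v → u ∉ rest → u ≢ w → v ∈ rest → Center → Settled u v

  Good : List (Fin n) → PartialColoring n → Set
  Good rest P = Bounded P × P w ≡ 0 × (∀ u → u ∈ rest → P u ≡ 0) ×
    (∀ u → u ∉ rest → u ≢ w → P u ≢ 0 × (Center → Allowed P u))

  -- The colorings that the search must not miss. Vertices of `N[w]` are exempt because color 0
  -- belongs to `w` alone; the others have to be happy through the colors 1, ..., q.
  Target : PartialColoring n → Set
  Target T = Bounded T × T w ≡ 0 × (∀ u → u ≢ w → T u ≢ 0) × (∀ u → Mem w u ⊎ Happy (colors q) T u)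

  Restricts : PartialColoring n → List (Fin n) → PartialColoring n → Set
  Restricts T rest T′ = ∀ u → (u ∈ rest × T′ u ≡ 0) ⊎ (u ∉ rest × T′ u ≡ T u)

  -- `T′` is the part of `T` colored so far. The table contains an entry equivalent to it, which may
  -- differ from `T` outside X.
  Complete : List (Fin n) → List (PartialColoring n) → Set
  Complete rest L = Center → ∀ T → Target T → ∃[ T′ ] Restricts T rest T′ × Covered L T′

  equiv-trans : ∀ {P Q R} → Equiv P Q → Equiv Q R → Equiv P R
  equiv-trans e f = All.tabulate λ x∈ → All.tabulate λ c∈ →
    let a , b , c    = All.lookup (All.lookup e x∈) c∈
        a′ , b′ , c′ = All.lookup (All.lookup f x∈) c∈
    in a′ ⇔-∘ a , b′ ⇔-∘ b , c′ ⇔-∘ c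

  -- Coloring `v` with `a` adds one to the count of `a` in every `N[x]` containing `v` and leaves
  -- the counts of the other nonzero colors alone. Counts truncated at two determine the truncated
  -- counts after adding one, so one entry per class is enough. For this `v` must be uncolored on
  -- both sides.
  equiv-update : ∀ {P P′ v a} → Equiv P P′ → P v ≡ 0 → P′ v ≡ 0 → Equiv (P [ v ≔ a ]) (P′ [ v ≔ a ])
  equiv-update {P} {P′} {v} {a} e Pv≡0 P′v≡0 = All.tabulate λ {x} x∈ → All.tabulate λ {c} c∈ →
    let color , some , unique = All.lookup (All.lookup e x∈) c∈
        c≢0 = colors-≢0 c∈
    in mk⇔ (color-update (to color)) (color-update (from color)) ,
       mk⇔ (some-update Pv≡0 P′v≡0 c≢0 (to some)) (some-update P′v≡0 Pv≡0 c≢0 (from some)) ,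
       mk⇔ (unique-update Pv≡0 P′v≡0 c≢0 (from some) (to unique))
           (unique-update P′v≡0 Pv≡0 c≢0 (to some) (from unique))
    where
    open Equivalence
    color-update : ∀ {Q Q′ x c} → (Q x ≡ c → Q′ x ≡ c) → (Q [ v ≔ a ]) x ≡ c → (Q′ [ v ≔ a ]) x ≡ c
    color-update {Q} {Q′} {x} f p with x Fin.≟ v
    ... | yes refl = ≡.trans (updated Q′ v) (≡.trans (≡.sym (updated Q v)) p)
    ... | no x≢v   = ≡.trans (unchanged Q′ v x≢v) (f (≡.trans (≡.sym (unchanged Q v x≢v)) p))

  ordered-∉ : ∀ {v rest} → Ordered (v ∷ rest) → v ∉ rest
  ordered-∉ (v≢ ∷ _) v∈ = proj₁ (All.lookup v≢ v∈) refl

  past-step : ∀ {v rest} → Ordered (v ∷ rest) → Past (v ∷ rest) → Past rest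
  past-step {v} (settled ∷ _) past u z u∉ u≢w z∈ center with u Fin.≟ v
  ... | yes refl = proj₂ (All.lookup settled z∈) center
  ... | no u≢v   = past u z (∉-∷ u≢v u∉) u≢w (there z∈) center

  good-skip : ∀ {P rest} → Good (w ∷ rest) P → Good rest P
  good-skip (bounded , Pw , zeros , done) =
    bounded , Pw , (λ u u∈ → zeros u (there u∈)) , λ u u∉ u≢w → done u (∉-∷ u≢w u∉) u≢w

  good-step : ∀ {P v rest a} → Ordered (v ∷ rest) → Past (v ∷ rest) → v ≢ w → Good (v ∷ rest) P →
              Bounded (P [ v ≔ a ]) → a ≢ 0 → Allowed (P [ v ≔ a ]) v → Good rest (P [ v ≔ a ])
  good-step {P} {v} {rest} {a} ordered past v≢w (_ , Pw , zeros , done) bounded a≢0 allowed =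
    bounded , ≡.trans (unchanged P v (v≢w ∘ ≡.sym)) Pw ,
    (λ u u∈ → ≡.trans (unchanged P v (λ { refl → ordered-∉ ordered u∈ })) (zeros u (there u∈))) ,
    done′
    where
    done′ : ∀ u → u ∉ rest → u ≢ w → (P [ v ≔ a ]) u ≢ 0 × (Center → Allowed (P [ v ≔ a ]) u)
    done′ u u∉ u≢w with u Fin.≟ v
    ... | yes refl = (λ p → a≢0 (≡.trans (≡.sym (updated P v)) p)) , λ _ → allowed
    ... | no u≢v = let Pu≢0 , allowed-u = done u (∉-∷ u≢v u∉) u≢w in
      (λ p → Pu≢0 (≡.trans (≡.sym (unchanged P v u≢v)) p)) ,
      -- An earlier vertex stays allowed: coloring `v` changes nothing in `N[u]` unless `u` lies in
      -- X or `N[w]`, and those are allowed anyway.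
      λ center → keep (past u v (∉-∷ u≢v u∉) u≢w (here refl) center) (allowed-u center)
      where
      keep : Settled u v → Allowed P u → Allowed (P [ v ≔ a ]) u
      keep _ (inj₁ u∈)        = inj₁ u∈
      keep _ (inj₂ (inj₁ m))  = inj₂ (inj₁ m)
      keep (inj₁ u∈) _        = inj₁ u∈
      keep (inj₂ (inj₁ m)) _  = inj₂ (inj₁ m)
      keep (inj₂ (inj₂ ¬m)) (inj₂ (inj₂ happy)) = inj₂ (inj₂ (Any.map (unique-cong same) happy))
        where
        same : ∀ {c z} → Mem u z → P z ≡ c ⇔ (P [ v ≔ a ]) z ≡ c
        same m = ≡-⇔ (≡.sym (unchanged P v (λ { refl → ¬m m })))

  -- A target also gives `w` the color 0, so `w` can be counted as colored without any change.
  restricts-skip : ∀ {T T′ rest} → w ∉ rest → T w ≡ 0 → Restricts T (w ∷ rest) T′ → Restricts T rest T′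
  restricts-skip w∉ Tw r u with r u
  ... | inj₁ (here refl , p) = inj₂ (w∉ , ≡.trans p (≡.sym Tw))
  ... | inj₁ (there u∈ , p)  = inj₁ (u∈ , p)
  ... | inj₂ (u∉ , p)        = inj₂ (u∉ ∘ there , p)

  restricts-step : ∀ {T T′ v rest} → v ∉ rest → Restricts T (v ∷ rest) T′ → Restricts T rest (T′ [ v ≔ T v ])
  restricts-step {T} {T′} {v} v∉ r u with u Fin.≟ v
  ... | yes refl = inj₂ (v∉ , updated T′ v)
  ... | no u≢v with r u
  ...   | inj₁ (here u≡v , p) = ⊥-elim (u≢v u≡v)
  ...   | inj₁ (there u∈ , p) = inj₁ (u∈ , ≡.trans (unchanged T′ v u≢v) p)
  ...   | inj₂ (u∉ , p)       = inj₂ (u∉ ∘ there , ≡.trans (unchanged T′ v u≢v) p)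

  restricts-zero : ∀ {T T′ v rest} → Restricts T (v ∷ rest) T′ → T′ v ≡ 0
  restricts-zero {v = v} r with r v
  ... | inj₁ (_ , p)  = p
  ... | inj₂ (v∉ , _) = ⊥-elim (v∉ (here refl))

  -- If `v` is outside X and `N[w]`, its neighbors lie in X and none of them is still to be colored.
  -- `Equiv` fixes the colors on X, so `P` extended at `v` agrees with `T` on `N[v]` as far as the
  -- colors 1, ..., q are concerned.
  target-allowed : ∀ {P T T′ v rest} → Ordered (v ∷ rest) → Center → Target T → Restricts T (v ∷ rest) T′ →
                   Equiv P T′ → Allowed (P [ v ≔ T v ]) v
  target-allowed {P} {T} {T′} {v} {rest} (settled ∷ _) center (_ , _ , _ , happy) restricts e
    with v ∈? Xs | mem? w v | happy v
  ... | yes v∈ | _      | _      = inj₁ v∈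
  ... | no v∉  | yes m  | _      = inj₂ (inj₁ m)
  ... | no v∉  | no ¬m  | inj₁ m = ⊥-elim (¬m m)
  ... | no v∉  | no ¬m  | inj₂ h =
    let c , c∈ , unique = find h in inj₂ (inj₂ (lose c∈ (unique-cong (same c∈) unique)))
    where
    future : ∀ {z} → z ∈ rest → ¬ Mem v z
    future z∈ m with proj₂ (All.lookup settled z∈) center
    ... | inj₁ v∈         = v∉ v∈
    ... | inj₂ (inj₁ m′)  = ¬m m′
    ... | inj₂ (inj₂ ¬m′) = ¬m′ m
    same : ∀ {c z} → c ∈ colors q → Mem v z → T z ≡ c ⇔ (P [ v ≔ T v ]) z ≡ c
    same {z = z} c∈ m with z Fin.≟ v
    ... | yes refl = ≡-⇔ (≡.sym (updated P v))
    ... | no z≢v with m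
    ...   | inj₁ v≡z = ⊥-elim (z≢v (≡.sym v≡z))
    ...   | inj₂ vz with restricts z
    ...     | inj₁ (here z≡v , _) = ⊥-elim (z≢v z≡v)
    ...     | inj₁ (there z∈ , _) = ⊥-elim (future z∈ m)
    ...     | inj₂ (_ , p) =
      ≡-⇔ (≡.sym (unchanged P v z≢v)) ⇔-∘
      (⇔-sym (proj₁ (All.lookup (All.lookup e (center v z v∉ ¬m vz)) c∈)) ⇔-∘ ≡-⇔ (≡.sym p))

  Solution : PartialColoring n → Set
  Solution P = Bounded P × (∀ v → Happy (0 ∷ colors q) P v)

  -- There is one reason for each kind of vertex: `N[w]` has color 0, which only `w` carries in the
  -- end; X sees the same in `P` as in `T` by `Equiv`; any other vertex was judged when it was
  -- colored.
  target-solution : ∀ {P T T′} → Center → Target T → Restricts T [] T′ → Good [] P → Equiv P T′ → Solution P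
  target-solution {P} {T} {T′} center (_ , _ , _ , happy) restricts (bounded , Pw , _ , done) e =
    bounded , solved
    where
    by-center : ∀ {v} → Mem w v → Unique P v 0
    by-center {v} m = w , (mem-sym m , Pw) , λ u (_ , p) → only u p
      where
      only : ∀ u → P u ≡ 0 → w ≡ u
      only u p with u Fin.≟ w
      ... | yes refl = refl
      ... | no u≢w   = ⊥-elim (proj₁ (done u (λ ()) u≢w) p)
    solved : ∀ v → Happy (0 ∷ colors q) P v
    solved v with mem? w v | v ∈? Xs | happy v
    ... | yes m | _      | _      = here (by-center m)
    ... | no ¬m | _      | inj₁ m = ⊥-elim (¬m m)
    ... | no ¬m | yes v∈ | inj₂ h =
      let c , c∈ , unique = find h
          _ , _ , same = All.lookup (All.lookup e v∈) c∈
      in there (lose c∈ (Equivalence.from same (unique-cong (λ {u} _ → same-color u) unique)))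
      where
      same-color : ∀ {c} u → T u ≡ c ⇔ T′ u ≡ c
      same-color u with inj₂ (_ , p) ← restricts u = ≡-⇔ (≡.sym p)
    ... | no ¬m | no v∉  | inj₂ _ with proj₂ (done v (λ ()) (λ { refl → ¬m (inj₁ refl) })) center
    ...   | inj₁ v∈        = ⊥-elim (v∉ v∈)
    ...   | inj₂ (inj₁ m)  = ⊥-elim (¬m m)
    ...   | inj₂ (inj₂ h′) = there h′

-- The number of classes

module _ {A : Set} where

  Separated : List (A → Bool) → A → A → Set
  Separated ps a b = Any (λ p → p a ≢ p b) ps

  length-filters : ∀ (p : A → Bool) xs →
    length xs ≡ length (List.filter (λ a → p a Bool.≟ true) xs) + length (List.filter (λ a → p a Bool.≟ false) xs)
  length-filters p [] = refl
  length-filters p (x ∷ xs) with p x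
  ... | true  = cong suc (length-filters p xs)
  ... | false = ≡.trans (cong suc (length-filters p xs)) (≡.sym (ℕ.+-suc _ _))

  separated-tail : ∀ {p ps b xs} → All (λ a → p a ≡ b) xs → AllPairs (Separated (p ∷ ps)) xs →
                   AllPairs (Separated ps) xs
  separated-tail [] [] = []
  separated-tail (px ∷ pxs) (sx ∷ sxs) =
    All.zipWith (λ { (py , here ≢) → ⊥-elim (≢ (≡.trans px (≡.sym py))) ; (_ , there s) → s }) (pxs , sx)
    ∷ separated-tail pxs sxs

  -- Induction on the tests: the elements on which the first test gives a fixed answer have to be
  -- separated by the remaining tests, so each half has at most half of the claimed size.
  separated-length : ∀ ps {xs} → AllPairs (Separated ps) xs → length xs ≤ 2 ^ length ps
  separated-length [] []                  = z≤n
  separated-length [] ([] ∷ [])           = s≤s z≤n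
  separated-length [] ((() ∷ _) ∷ _)
  separated-length (p ∷ ps) {xs} separated = begin
    length xs                                  ≡⟨ length-filters p xs ⟩
    length (half true) + length (half false)   ≤⟨ ℕ.+-mono-≤ (short true) (short false) ⟩
    2 ^ length ps + 2 ^ length ps              ≡⟨ cong (2 ^ length ps +_) (ℕ.+-identityʳ (2 ^ length ps)) ⟨
    2 ^ length (p ∷ ps)                        ∎
    where
    open ℕ.≤-Reasoning
    half : Bool → List A
    half b = List.filter (λ a → p a Bool.≟ b) xs
    short : ∀ b → length (half b) ≤ 2 ^ length ps
    short b = separated-length ps
      (separated-tail (All.all-filter (λ a → p a Bool.≟ b) xs) (AllPairs.filter⁺ (λ a → p a Bool.≟ b) separated))

length-concatMap : ∀ {A B : Set} {f : A → List B} {k} → (∀ x → length (f x) ≡ k) → ∀ xs →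
                   length (List.concatMap f xs) ≡ length xs * k
length-concatMap eq [] = refl
length-concatMap {f = f} eq (x ∷ xs) =
  ≡.trans (List.length-++ (f x)) (≡.cong₂ _+_ (eq x) (length-concatMap eq xs))

does-⇔⁻ : ∀ {A B : Set} (a? : Dec A) (b? : Dec B) → does a? ≡ does b? → A ⇔ B
does-⇔⁻ (yes a) (yes b) _ = mk⇔ (const b) (const a)
does-⇔⁻ (no ¬a) (no ¬b) _ = mk⇔ (λ a → ⊥-elim (¬a a)) (λ b → ⊥-elim (¬b b))

module TableSize {n : ℕ} (G : Graph n) (Xs : List (Fin n)) (q : ℕ) (w : Fin n) where
  open Neighborhoods G
  open Updates G
  open Tables G Xs q w

  colored? : ∀ P x c u → Dec (Colored P x c u)
  colored? P x c u = mem? x u ×-dec P u ℕ.≟ c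

  some? : ∀ P x c → Dec (Some P x c)
  some? P x c = Fin.any? (colored? P x c)

  unique? : ∀ P x c → Dec (Unique P x c)
  unique? P x c = Fin.any? λ u → colored? P x c u ×-dec Fin.all? λ u′ → colored? P x c u′ →-dec u Fin.≟ u′

  tests : Fin n → ℕ → List (PartialColoring n → Bool)
  tests x c = (λ P → does (P x ℕ.≟ c)) ∷ (λ P → does (some? P x c)) ∷ (λ P → does (unique? P x c)) ∷ []

  allTests : List (PartialColoring n → Bool)
  allTests = List.concatMap (λ x → List.concatMap (tests x) (colors q)) Xs

  tests-equiv : ∀ {P P′} → All (λ p → p P ≡ p P′) allTests → Equiv P P′
  tests-equiv {P} {P′} same = All.map
    (λ {x} s → All.map (λ {c} → pointwise x c) (All.map⁻ (All.concat⁻ {xss = map (tests x) (colors q)} s)))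
    (All.map⁻ (All.concat⁻ {xss = map (λ x → List.concatMap (tests x) (colors q)) Xs} same))
    where
    pointwise : ∀ x c → All (λ p → p P ≡ p P′) (tests x c) → Same P P′ x c
    pointwise x c (a ∷ b ∷ d ∷ []) =
      does-⇔⁻ (P x ℕ.≟ c) (P′ x ℕ.≟ c) a , does-⇔⁻ (some? P x c) (some? P′ x c) b ,
      does-⇔⁻ (unique? P x c) (unique? P′ x c) d

  -- Each vertex of X and each color contribute three tests, and colorings with the same results are
  -- equivalent. Inequivalent entries are therefore separated by some test.
  distinct-length : ∀ {L} → Distinct L → length L ≤ 2 ^ (length Xs * (q * 3))
  distinct-length {L} distinct = ℕ.≤-trans
    (separated-length allTests
      (AllPairs.map (λ {P} {P′} ≄ → Any.map (λ ≢ ≡ → ≢ (≡.sym ≡))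
        (All.¬All⇒Any¬ (λ p → p P′ Bool.≟ p P) allTests (≄ ∘ tests-equiv))) distinct))
    (ℕ.≤-reflexive (cong (2 ^_) (length-concatMap (λ x → ≡.trans (length-concatMap (λ c → refl) (colors q))
      (cong (_* 3) (length-colors q))) Xs)))

-- A failed search returns `nil`, so a coloring that was found must be a different tree; this takes
-- at least one vertex.
encodePartial-nonempty : ∀ {n} → Fin n → (P : PartialColoring n) → ∃[ t ] ∃[ u ] encodePartial P ≡ cons t u
encodePartial-nonempty {suc n} _ P = _ , _ , refl

-- A single trial, with q and w fixed

module Trials {n : ℕ} (G : Graph n) (Xs : List (Fin n)) (q : ℕ) (w : Fin n)
              (M : ℕ) (n≤M : n ≤ M) (Xs≤M : length Xs ≤ M) (q<M : suc q ≤ M)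
              (short : ∀ {L} → Tables.Distinct G Xs q w L → length L ≤ M) where
  open Neighborhoods G
  open Tables G Xs q w
  open TableInvariants G Xs q w
  open Specification M n≤M Xs≤M q<M
  open Evaluation M
  open Combinators M

  Invariant : List (Fin n) → List (PartialColoring n) → Set
  Invariant rest L = Ordered rest × Past rest × All (Good rest) L × Distinct L × Complete rest L

  opaque
    unfolding stepᵉ

    step-⇓ : ∀ {v rest L} → Invariant (v ∷ rest) L →
      ∃[ L′ ] (instanceTree ∷ encodeTable L ∷ encodeFin v ∷ []) ⊢ stepᵉ ⇓ encodeTable L′ × Invariant rest L′
    step-⇓ {v} {rest} {L} (ordered@(_ ∷ ordered′) , past , good , distinct , complete) =
      if-invariant encodeTable (eqFin? n≤M (var _) (tlᵉ (tlᵉ (tlᵉ (tlᵉ (var _))))))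
        (λ { refl → L , var _ , ordered′ , past′ , All.map good-skip good , distinct , complete-skip refl })
        (λ v≢w → let L′ , r , (good′ , distinct′) , covers =
                       extendAll-⇓ (All.map proj₁ good) (short distinct)
                         λ Q a Q∈ a∈ allowed → good-step ordered past v≢w (All.lookup good Q∈)
                           (update-bounded {y = v} (proj₁ (All.lookup good Q∈)) (colors-≤ a∈)) (colors-≢0 a∈) allowed
                 in L′ , r , ordered′ , past′ , good′ , distinct′ , complete-step v≢w covers)
      where
      open Growth short (Good rest) proj₁
      past′ : Past rest
      past′ = past-step ordered past
      complete-skip : v ≡ w → Complete rest L
      complete-skip refl center T target =
        let T′ , restricts , covered = complete center T target
        in T′ , restricts-skip (ordered-∉ ordered) (proj₁ (proj₂ target)) restricts , covered
      complete-step : ∀ {L′} → v ≢ w →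
        (∀ Q a → Q ∈ L → a ∈ colors q → Allowed (Q [ v ≔ a ]) v → Covered L′ (Q [ v ≔ a ])) → Complete rest L′
      complete-step v≢w covers center T target@(bounded , _ , nonzero , _) =
        let T′ , restricts , covered = complete center T target
            P , P∈ , e = find covered
            _ , _ , zeros , _ = All.lookup good P∈
            e′ = equiv-update {a = T v} e (zeros v (here refl)) (restricts-zero restricts)
        in T′ [ v ≔ T v ] , restricts-step (ordered-∉ ordered) restricts ,
           -- The table holds `P` rather than `T′`. Extending `P` by the color that `T` gives to `v`
           -- is allowed, hence covered by some entry, and that entry is equivalent to the extended
           -- `T′` by transitivity.
           Any.map (λ f → equiv-trans f e′)
             (covers P (T v) P∈ (∈-colors (nonzero v v≢w) (bounded v))
               (target-allowed ordered center target restricts e))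

  module _ {order : List (Fin n)} (ordered : Ordered order)
           (all : ∀ u → u ∈ order) (order≤M : length order ≤ M) where

    opaque
      unfolding tableᵉ

      table-⇓ : ∃[ L ] (instanceTree ∷ encodeList encodeFin order ∷ encodePartial {n} (const 0) ∷ []) ⊢ tableᵉ
                         ⇓ encodeTable L ×
                       Invariant [] L
      table-⇓ =
        fold-invariant encodeFin encodeTable Invariant {s₀ = const 0 ∷ []} (consᵉ (var _) nilᵉ) (var _) order≤M
          -- At the start every vertex is still to come: the claims about colored vertices are
          -- vacuous, and every target restricts to `const 0`.
          (ordered , (λ u _ u∉ → ⊥-elim (u∉ (all u))) ,
           ((λ _ → z≤n) , refl , (λ _ _ → refl) , λ u u∉ → ⊥-elim (u∉ (all u))) ∷ [] , [] ∷ [] ,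
           λ _ T _ → const 0 , (λ u → inj₁ (all u , refl)) , here equiv-refl)
          λ _ i → let L′ , r , i′ = step-⇓ i in L′ , call (var _ ∷ var _ ∷ var _ ∷ []) r , i′

    opaque
      unfolding validᵉ

      valid? : ∀ {P} → Bounded P →
        (instanceTree ∷ encodePartial P ∷ []) ⊢ validᵉ ⇓? (∀ v → Happy (0 ∷ colors q) P v)
      valid? bounded = allVertices? (var _)
        (call? (var _ ∷ consᵉ nilᵉ (colors-⇓ (var _)) ∷ var _ ∷ var _ ∷ [])
          (happy? (ℕ.≤-trans (ℕ.≤-reflexive (cong suc (length-colors q))) q<M)
                  (λ { (here refl) → z≤n ; (there a∈) → colors-≤ a∈ }) bounded))

    opaque
      unfolding trialᵉ

      -- `validᵉ` certifies a success for whatever `w` is being tried; `Center` enters through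
      -- failure, which shows that no target exists if `w` is a center.
      trial-⇓ : ∃[ r ] (instanceTree ∷ encodeList encodeFin order ∷ encodePartial {n} (const 0) ∷ []) ⊢ trialᵉ
                         ⇓ encodeMaybe encodePartial r ×
                       Outcome (¬ (Center × ∃[ T ] Target T)) Solution r
      trial-⇓ =
        let L , r , _ , _ , good , distinct , complete = table-⇓
            m , r′ , outcome = first-⇓ encodePartial encodePartial (encodePartial-nonempty w)
              {A = Solution} {F = λ P → ¬ Solution P} {xs = L}
              (call (var _ ∷ var _ ∷ var _ ∷ []) r) (short distinct) (check good)
        in m , r′ , finish m good complete outcome
        where
        check : ∀ {L P s} → All (Good []) L → P ∈ L →
          ∃[ m ] (encodePartial P ∷ s ∷ instanceTree ∷ encodeList encodeFin order ∷ encodePartial {n} (const 0) ∷ [])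
                   ⊢ ifᵉ (call validᵉ (x₂ ∷ x₀ ∷ [])) x₀ nilᵉ ⇓ encodeMaybe encodePartial m ×
                 Outcome (¬ Solution P) Solution m
        check {P = P} good P∈ =
          let bounded = proj₁ (All.lookup good P∈) in
          if-invariant (encodeMaybe encodePartial) (call? (var _ ∷ var _ ∷ []) (valid? bounded))
            (λ happy → just P , var _ , bounded , happy)
            (λ ¬happy → nothing , nilᵉ , λ (_ , happy) → ¬happy happy)
        finish : ∀ {L} m → All (Good []) L → Complete [] L →
          Outcome (∀ {P} → P ∈ L → ¬ Solution P) Solution m → Outcome (¬ (Center × ∃[ T ] Target T)) Solution m
        finish (just P) _ _ solution = solution
        finish nothing good complete none (center , T , target) =
          let T′ , restricts , covered = complete center T target
              P , P∈ , e = find covered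
          in none P∈ (target-solution center target restricts (All.lookup good P∈) e)

-- Conflict-free colorings and threshold graphs

module _ {n : ℕ} {p : Subset n} where

  size-one⁺ : ∀ {u} → u Subset.∈ p → (∀ {z} → z Subset.∈ p → u ≡ z) → ∣ p ∣ ≡ 1
  size-one⁺ {u} u∈ only = ≡.trans (ℕ.≤-antisym
      (Subset.p⊆q⇒∣p∣≤∣q∣ λ {z} z∈ → subst (λ y → z Subset.∈ ⁅ y ⁆) (≡.sym (only z∈)) (Subset.x∈⁅x⁆ z))
      (Subset.p⊆q⇒∣p∣≤∣q∣ λ {z} z∈ → subst (Subset._∈ p) (≡.sym (Subset.x∈⁅y⁆⇒x≡y u z∈)) u∈))
    (Subset.∣⁅x⁆∣≡1 u)

  size-one⁻ : ∣ p ∣ ≡ 1 → ∃[ u ] u Subset.∈ p × (∀ {z} → z Subset.∈ p → u ≡ z)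
  size-one⁻ size with Subset.nonempty? p
  ... | no empty with () ← ≡.trans (≡.sym size)
    (≡.trans (cong ∣_∣ (Subset.Empty-unique empty)) (Subset.∣⊥∣≡0 n))
  ... | yes (u , u∈) = u , u∈ , only
    where
    only : ∀ {z} → z Subset.∈ p → u ≡ z
    only {z} z∈ with u Fin.≟ z
    ... | yes u≡z = u≡z
    ... | no u≢z with subst (∣ p Subset.- u ∣ <_) size (Subset.x∈p⇒∣p-x∣<∣p∣ u∈)
    ...   | s≤s small with () ← ℕ.<-≤-trans
            (Subset.x∈p⇒∣p-x∣<∣p∣ (Subset.x∈p∧x≢y⇒x∈p-y z∈ (u≢z ∘ ≡.sym))) small

tabulate-∈ : ∀ {n} {f : Fin n → Bool} {u} → u Subset.∈ Vec.tabulate f ⇔ T (f u)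
tabulate-∈ {f = f} {u} = mk⇔
  (λ u∈ → subst T (≡.sym (≡.trans (≡.sym (Vec.lookup∘tabulate f u)) (Vec.[]=⇒lookup u∈))) _)
  (λ t → Vec.lookup⇒[]= u _ (≡.trans (Vec.lookup∘tabulate f u) (T-≡ t)))
  where
  T-≡ : ∀ {b} → T b → b ≡ true
  T-≡ {true} _ = refl

-- The search ranges over the value at `zero` and a function on the rest. A given `f` agrees only
-- pointwise with the function put together from these parts, so `P` has to respect pointwise
-- equality.
existsFunction? : ∀ m {k} {P : (Fin m → Fin k) → Set} → (∀ {f g} → (∀ i → f i ≡ g i) → P f → P g) →
                  (∀ f → Dec (P f)) → Dec (∃[ f ] P f)
existsFunction? zero resp dec with dec (λ ())
... | yes p = yes (_ , p)
... | no ¬p = no λ (f , p) → ¬p (resp (λ ()) p)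
existsFunction? (suc m) {P = P} resp dec
  with Fin.any? (λ a → existsFunction? m {P = λ f → P (a F.∷ f)}
         (λ eq → resp λ { zero → refl ; (suc i) → eq i }) (λ f → dec (a F.∷ f)))
... | yes (a , f , p) = yes (_ , p)
... | no ¬p = no λ (f , p) → ¬p (f zero , f ∘ suc , resp (λ { zero → refl ; (suc i) → refl }) p)

least : ∀ {P : ℕ → Set} → (∀ k → Dec (P k)) → ∀ m → P m → ∃[ χ ] P χ × (∀ k → P k → χ ≤ k)
least dec zero p = 0 , p , λ _ _ → z≤n
least {P} dec (suc m) p with dec 0
... | yes p₀ = 0 , p₀ , λ _ _ → z≤n
... | no ¬p₀ =
  let χ , pχ , minimal = least {P ∘ suc} (dec ∘ suc) m p
  in suc χ , pχ , λ { zero q → ⊥-elim (¬p₀ q) ; (suc k) q → s≤s (minimal k q) }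

module ConflictFree {n : ℕ} (G : Graph n) where
  open Neighborhoods G

  class-∈ : ∀ {k} (C : Coloring n k) {c u} → u Subset.∈ colorClass C c ⇔ C u ≡ c
  class-∈ C {c} {u} = mk⇔ T-does does-T ⇔-∘ tabulate-∈
    where
    T-does : T (does (C u Fin.≟ c)) → C u ≡ c
    T-does t with yes eq ← C u Fin.≟ c = eq
    does-T : C u ≡ c → T (does (C u Fin.≟ c))
    does-T eq with C u Fin.≟ c
    ... | yes _  = _
    ... | no ≢   = ≢ eq

  neighborhood-∈ : ∀ {v u} → u Subset.∈ N[_] G v ⇔ Mem v u
  neighborhood-∈ {v} {u} = mk⇔ to from
    where
    to : u Subset.∈ N[_] G v → Mem v u
    to u∈ with Subset.x∈p∪q⁻ ⁅ v ⁆ _ u∈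
    ... | inj₁ u∈v = inj₁ (≡.sym (Subset.x∈⁅y⁆⇒x≡y v u∈v))
    ... | inj₂ uv  = inj₂ (Equivalence.to tabulate-∈ uv)
    from : Mem v u → u Subset.∈ N[_] G v
    from (inj₁ refl) = Subset.x∈p∪q⁺ (inj₁ (Subset.x∈⁅x⁆ v))
    from (inj₂ vu)   = Subset.x∈p∪q⁺ (inj₂ (Equivalence.from tabulate-∈ vu))

  UniqueIn : ∀ {k} → Coloring n k → Fin n → Fin k → Set
  UniqueIn C v c = ∃[ u ] (Mem v u × C u ≡ c) × (∀ z → Mem v z × C z ≡ c → u ≡ z)

  uniqueColor : ∀ {k} {C : Coloring n k} {v} → HasUniqueColor C (N[_] G v) ⇔ (∃[ c ] UniqueIn C v c)
  uniqueColor {C = C} {v} = mk⇔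
    (λ (c , size) → let u , u∈ , only = size-one⁻ size in
      c , u , split u∈ , λ z q → only (join q))
    (λ (c , u , q , only) → c , size-one⁺ (join q) (λ z∈ → only _ (split z∈)))
    where
    split : ∀ {c u} → u Subset.∈ N[_] G v Subset.∩ colorClass C c → Mem v u × C u ≡ c
    split u∈ = let a , b = Subset.x∈p∩q⁻ (N[_] G v) _ u∈
               in Equivalence.to neighborhood-∈ a , Equivalence.to (class-∈ C) b
    join : ∀ {c u} → Mem v u × C u ≡ c → u Subset.∈ N[_] G v Subset.∩ colorClass C c
    join (m , p) = Subset.x∈p∩q⁺ (Equivalence.from neighborhood-∈ m , Equivalence.from (class-∈ C) p)

  UniquelyColored : ∀ {k} → Coloring n k → Set
  UniquelyColored C = ∀ v → ∃[ c ] UniqueIn C v c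

  cfcn : ∀ {k} {C : Coloring n k} → IsCFCN G C ⇔ UniquelyColored C
  cfcn = mk⇔ (λ h v → Equivalence.to uniqueColor (h v)) (λ h v → Equivalence.from uniqueColor (h v))

  uniquelyColored? : ∀ {k} (C : Coloring n k) → Dec (UniquelyColored C)
  uniquelyColored? C = Fin.all? λ v → Fin.any? λ c → Fin.any? λ u →
    (mem? v u ×-dec C u Fin.≟ c) ×-dec Fin.all? λ z → (mem? v z ×-dec C z Fin.≟ c) →-dec u Fin.≟ z
    where open Updates G

  uniquelyColored-resp : ∀ {k} {C C′ : Coloring n k} → (∀ u → C u ≡ C′ u) → UniquelyColored C → UniquelyColored C′
  uniquelyColored-resp eq h v =
    let c , u , (m , p) , only = h v
    in c , u , (m , ≡.trans (≡.sym (eq u)) p) , λ z (m′ , p′) → only z (m′ , ≡.trans (eq z) p′)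

  colorable? : ∀ k → Dec (CFCNColorable G k)
  colorable? k with existsFunction? n uniquelyColored-resp (uniquelyColored? {k})
  ... | yes (C , h) = yes (C , Equivalence.from cfcn h)
  ... | no ¬h       = no λ (C , h) → ¬h (C , Equivalence.to cfcn h)

  colorable-n : CFCNColorable G n
  colorable-n = (λ v → v) , Equivalence.from cfcn λ v → v , v , (inj₁ refl , refl) , λ z (_ , p) → ≡.sym p

  -- The minimum has to be produced as a witness. Colorability with k colors is decidable, so a
  -- search from below finds it, and it ends because n colors suffice.
  χ-exists : ∃[ χ ] χcf[ G ]≡ χ
  χ-exists = least colorable? n colorable-n

-- The coloring order, the center of a threshold graph and the existence of targets

module Special {n : ℕ} (G : Graph n) (X : Subset n) where
  open Neighborhoods G
  open Updates G
  open ConflictFree G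

  special regular order : List (Fin n)
  special = List.filter (Subset._∈? X) (allFin n)
  regular = List.filter (λ v → ¬? (v Subset.∈? X)) (allFin n)
  order   = special List.++ regular

  open DecMembership (Fin._≟_ {n}) using (_∈?_)

  ∈-special : ∀ {v} → v ∈ special ⇔ v Subset.∈ X
  ∈-special {v} = mk⇔
    (λ v∈ → proj₂ (List.∈-filter⁻ (Subset._∈? X) {xs = allFin n} v∈))
    (List.∈-filter⁺ (Subset._∈? X) (List.∈-allFin v))

  ∉-special : ∀ {v} → v ∈ regular → v ∉ special
  ∉-special v∈ v∈X =
    proj₂ (List.∈-filter⁻ (λ v → ¬? (v Subset.∈? X)) {xs = allFin n} v∈) (Equivalence.to ∈-special v∈X)

  ∈-order : ∀ v → v ∈ order
  ∈-order v with v Subset.∈? X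
  ... | yes v∈ = List.∈-++⁺ˡ (Equivalence.from ∈-special v∈)
  ... | no v∉  = List.∈-++⁺ʳ special (List.∈-filter⁺ (λ v → ¬? (v Subset.∈? X)) (List.∈-allFin v) v∉)

  length-special : length special ≡ ∣ X ∣
  length-special = ≡.trans (length-filter-tabulate (λ u → u))
    (cong ∣_∣ (≡.trans (Vec.tabulate-cong (does-∈? X)) (Vec.tabulate∘lookup X)))
    where
    length-filter-tabulate : ∀ {m} (f : Fin m → Fin n) →
      length (List.filter (Subset._∈? X) (tabulate f)) ≡ ∣ Vec.tabulate (λ u → does (f u Subset.∈? X)) ∣
    length-filter-tabulate {zero} f = refl
    length-filter-tabulate {suc m} f with does (f zero Subset.∈? X)
    ... | true  = cong suc (length-filter-tabulate (f ∘ suc))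
    ... | false = length-filter-tabulate (f ∘ suc)

    does-∈? : ∀ {m} (Y : Subset m) u → does (u Subset.∈? Y) ≡ lookup Y u
    does-∈? (true ∷ Y)  zero    = refl
    does-∈? (false ∷ Y) zero    = refl
    does-∈? (y ∷ Y)     (suc u) with u Subset.∈? Y | does-∈? Y u
    ... | yes _ | eq = eq
    ... | no _  | eq = eq

  module _ (q : ℕ) (w : Fin n) where
    open TableInvariants G special q w using (Center; Ordered; Settled; Target)
    open Tables G special q w using (Bounded)

    -- A pair starting in X is settled at once. For two vertices outside X, the first is in `N[w]`
    -- or has all its neighbors in X, hence is not adjacent to the second.
    order-ordered : Ordered order
    order-ordered = AllPairs.++⁺
      (early (AllPairs.filter⁺ (Subset._∈? X) (Unique.allFin⁺ n)) (λ u∈ → u∈))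
      (late (AllPairs.filter⁺ (λ v → ¬? (v Subset.∈? X)) (Unique.allFin⁺ n)) ∉-special)
      (All.tabulate λ u∈ → All.tabulate λ v∈ → (λ { refl → ∉-special v∈ u∈ }) , λ _ → inj₁ u∈)
      where
      early : ∀ {us} → AllPairs _≢_ us → (∀ {u} → u ∈ us → u ∈ special) → Ordered us
      early [] _ = []
      early (≢s ∷ rest) special-u =
        All.map (λ ≢ → ≢ , λ _ → inj₁ (special-u (here refl))) ≢s ∷ early rest (special-u ∘ there)
      settled : ∀ {u v} → u ≢ v → u ∉ special → v ∉ special → Center → Settled u v
      settled {u} {v} u≢v u∉ v∉ center with mem? w u
      ... | yes m = inj₂ (inj₁ m)
      ... | no ¬m = inj₂ (inj₂ λ { (inj₁ u≡v) → u≢v u≡v ; (inj₂ uv) → v∉ (center u v u∉ ¬m uv) })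
      late : ∀ {us} → AllPairs _≢_ us → (∀ {u} → u ∈ us → u ∉ special) → Ordered us
      late [] _ = []
      late (≢s ∷ rest) regular-u =
        All.tabulate (λ v∈ → All.lookup ≢s v∈ ,
          settled (All.lookup ≢s v∈) (regular-u (here refl)) (regular-u (there v∈)))
        ∷ late rest (regular-u ∘ there)

  HasTargetAt : ℕ → Fin n → Set
  HasTargetAt q w = TableInvariants.Center G special q w × ∃[ T ] TableInvariants.Target G special q w T

  HasTarget : ℕ → Set
  HasTarget q = ∃[ w ] HasTargetAt q w

  -- `w` is the last universal vertex added, or the initial vertex if there was none. It is adjacent
  -- to everything present when it was added, and the isolated vertices added later get no
  -- neighbors.
  threshold-center : ∀ {S} → Threshold G S →
    ∃[ w ] w Subset.∈ S × (∀ {v} → v Subset.∈ S → Mem w v ⊎ (∀ u → u Subset.∈ S → ¬ Adj G v u))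
  threshold-center (single v) =
    v , Subset.x∈⁅x⁆ v , λ u∈ → inj₁ (inj₁ (≡.sym (Subset.x∈⁅y⁆⇒x≡y v u∈)))
  threshold-center (isolated {S} v t _ ¬adj) =
    let w , w∈ , h = threshold-center t
    in w , Subset.x∈p∪q⁺ (inj₂ w∈) , λ z∈ → extend h (Subset.x∈p∪q⁻ ⁅ v ⁆ S z∈)
    where
    loopless : ¬ Adj G v v
    loopless a = subst T (irrefl G v) a
    extend : ∀ {w z} → (∀ {v} → v Subset.∈ S → Mem w v ⊎ (∀ u → u Subset.∈ S → ¬ Adj G v u)) →
      z Subset.∈ ⁅ v ⁆ ⊎ z Subset.∈ S → Mem w z ⊎ (∀ u → u Subset.∈ ⁅ v ⁆ Subset.∪ S → ¬ Adj G z u)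
    extend h (inj₁ z∈v) with refl ← Subset.x∈⁅y⁆⇒x≡y v z∈v =
      inj₂ λ u u∈ a → Sum.[
        (λ u∈v → loopless (subst (Adj G v) (Subset.x∈⁅y⁆⇒x≡y v u∈v) a)) ,
        (λ u∈S → ¬adj u u∈S a) ]′
        (Subset.x∈p∪q⁻ ⁅ v ⁆ S u∈)
    extend {z = z} h (inj₂ z∈S) with h z∈S
    ... | inj₁ m = inj₁ m
    ... | inj₂ f = inj₂ λ u u∈ a → Sum.[
        (λ u∈v → ¬adj z z∈S (subst T (Graph.sym G z v) (subst (Adj G z) (Subset.x∈⁅y⁆⇒x≡y v u∈v) a))) ,
        (λ u∈S → f u u∈S a) ]′ (Subset.x∈p∪q⁻ ⁅ v ⁆ S u∈)
  threshold-center (universal {S} v t _ adj-all) =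
    v , Subset.x∈p∪q⁺ (inj₁ (Subset.x∈⁅x⁆ v)) , λ z∈ → inj₁ (Sum.[
      (λ z∈v → inj₁ (≡.sym (Subset.x∈⁅y⁆⇒x≡y v z∈v))) , (λ z∈S → inj₂ (adj-all _ z∈S)) ]′ (Subset.x∈p∪q⁻ ⁅ v ⁆ S z∈))

  center-exists : ∀ q → Threshold G (∁ X) → ∃[ w ] TableInvariants.Center G special q w
  center-exists q t = let w , _ , h = threshold-center t in w , λ v u v∉ ¬m vu → center h v∉ ¬m vu
    where
    regular-∁ : ∀ {v} → v ∉ special → v Subset.∈ ∁ X
    regular-∁ v∉ = Subset.x∉p⇒x∈∁p (λ v∈ → v∉ (Equivalence.from ∈-special v∈))
    center : ∀ {w v u} → (∀ {v} → v Subset.∈ ∁ X → Mem w v ⊎ (∀ u → u Subset.∈ ∁ X → ¬ Adj G v u)) →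
      v ∉ special → ¬ Mem w v → Adj G v u → u ∈ special
    center {u = u} h v∉ ¬m vu with u ∈? special
    ... | yes u∈ = u∈
    ... | no u∉ with h (regular-∁ v∉)
    ...   | inj₁ m = ⊥-elim (¬m m)
    ...   | inj₂ f = ⊥-elim (f u (regular-∁ u∉) vu)

  -- w gets the new color 0; every vertex outside N[w] keeps the color it saw only once.
  coloring-target : ∀ {χ} → Threshold G (∁ X) → CFCNColorable G χ → HasTarget χ
  coloring-target {χ} t (C , conflict-free) =
    w , center , shifted , bounded , at-w , (λ u u≢w → nonzero u≢w) , happy
    where
    w = proj₁ (center-exists χ t)
    center = proj₂ (center-exists χ t)
    shifted : PartialColoring n
    shifted = (suc ∘ toℕ ∘ C) [ w ≔ 0 ]
    at-w : shifted w ≡ 0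
    at-w = updated (suc ∘ toℕ ∘ C) w
    elsewhere : ∀ {u} → u ≢ w → shifted u ≡ suc (toℕ (C u))
    elsewhere = unchanged (suc ∘ toℕ ∘ C) w
    nonzero : ∀ {u} → u ≢ w → shifted u ≢ 0
    nonzero u≢w p = ℕ.0≢1+n (≡.trans (≡.sym p) (elsewhere u≢w))
    bounded : ∀ u → shifted u ≤ χ
    bounded u with u Fin.≟ w
    ... | yes refl = ℕ.≤-trans (ℕ.≤-reflexive at-w) z≤n
    ... | no u≢w   = ℕ.≤-trans (ℕ.≤-reflexive (elsewhere u≢w)) (toℕ<n (C u))
    happy : ∀ v → Mem w v ⊎ Happy (colors χ) shifted v
    happy v with mem? w v
    ... | yes m = inj₁ m
    ... | no ¬m =
      let c , u , (m , p) , only = Equivalence.to cfcn conflict-free v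
      in inj₂ (lose (∈-colors {χ} {suc (toℕ c)} (λ ()) (toℕ<n c))
           (u , (m , ≡.trans (elsewhere (away m)) (cong (suc ∘ toℕ) p)) ,
            λ z (m′ , p′) → only z (m′ , toℕ-injective (ℕ.suc-injective (≡.trans (≡.sym (elsewhere (away m′))) p′)))))
      where
      away : ∀ {u} → Mem v u → u ≢ w
      away m refl = ¬m (mem-sym m)

  -- Distinct colors on X, color 0 on w, and one more color for everything else.
  default-target : Threshold G (∁ X) → HasTarget (suc (length special))
  default-target t = w , center , rainbow , bounded , at-w , (λ u u≢w → nonzero u≢w) , happy
    where
    d = length special
    w = proj₁ (center-exists (suc d) t)
    center = proj₂ (center-exists (suc d) t)
    color : PartialColoring n
    color u with u ∈? special
    ... | yes u∈ = suc (toℕ (Any.index u∈))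
    ... | no _   = suc d
    rainbow : PartialColoring n
    rainbow = color [ w ≔ 0 ]
    at-w : rainbow w ≡ 0
    at-w = updated color w
    elsewhere : ∀ {u} → u ≢ w → rainbow u ≡ color u
    elsewhere = unchanged color w
    color≢0 : ∀ u → color u ≢ 0
    color≢0 u p with u ∈? special
    color≢0 u () | yes _
    color≢0 u () | no _
    nonzero : ∀ {u} → u ≢ w → rainbow u ≢ 0
    nonzero {u} u≢w p = color≢0 u (≡.trans (≡.sym (elsewhere u≢w)) p)
    color≤ : ∀ u → color u ≤ suc d
    color≤ u with u ∈? special
    ... | yes u∈ = s≤s (ℕ.<⇒≤ (toℕ<n (Any.index u∈)))
    ... | no _   = ℕ.≤-refl
    bounded : ∀ u → rainbow u ≤ suc d
    bounded u with u Fin.≟ w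
    ... | yes refl = ℕ.≤-trans (ℕ.≤-reflexive at-w) z≤n
    ... | no u≢w   = ℕ.≤-trans (ℕ.≤-reflexive (elsewhere u≢w)) (color≤ u)
    color-injective : ∀ {u v} → u ∈ special → color v ≡ color u → v ≡ u
    color-injective {u} {v} u∈X p with u ∈? special | v ∈? special
    ... | yes u∈ | yes v∈ =
      SetoidMembership.index-injective (≡.setoid (Fin n)) v∈ u∈ (toℕ-injective (ℕ.suc-injective p))
    ... | yes u∈ | no _ = ⊥-elim (ℕ.<⇒≢ (toℕ<n (Any.index u∈)) (≡.sym (ℕ.suc-injective p)))
    ... | no u∉  | _ = ⊥-elim (u∉ u∈X)
    color-regular : ∀ {u} → u ∈ special → color u ≢ suc d
    color-regular {u} u∈X p with u ∈? special
    ... | yes u∈ = ℕ.<⇒≢ (toℕ<n (Any.index u∈)) (ℕ.suc-injective p)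
    ... | no u∉  = u∉ u∈X
    color-outside : ∀ {u} → u ∉ special → color u ≡ suc d
    color-outside {u} u∉ with u ∈? special
    ... | yes u∈ = ⊥-elim (u∉ u∈)
    ... | no _   = refl
    happy : ∀ v → Mem w v ⊎ Happy (colors (suc d)) rainbow v
    happy v with mem? w v
    ... | yes m = inj₁ m
    -- The color of `v` itself is unique in `N[v]`: no other vertex shares the color of a vertex of
    -- X, and for `v` outside X the rest of `N[v]` lies in X, where the last color does not occur.
    ... | no ¬m = inj₂ (lose (∈-colors (color≢0 v) (color≤ v)) (v , (inj₁ refl , elsewhere (away (inj₁ refl))) , only))
      where
      away : ∀ {u} → Mem v u → u ≢ w
      away m refl = ¬m (mem-sym m)
      only : ∀ u → Colored rainbow v (color v) u → v ≡ u
      only u (m , p) = decide (v ∈? special) m (≡.trans (≡.sym (elsewhere (away m))) p)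
        where
        decide : Dec (v ∈ special) → Mem v u → color u ≡ color v → v ≡ u
        decide (yes v∈) _ eq         = ≡.sym (color-injective v∈ eq)
        decide (no v∉) (inj₁ v≡u) eq = v≡u
        decide (no v∉) (inj₂ vu) eq  =
          ⊥-elim (color-regular (center v u v∉ ¬m vu) (≡.trans eq (color-outside v∉)))

-- The search over q and w

opaque
  -- colors, graph, vertices, X, order, the uncolored P
  searchᵉ : Exp 6
  searchᵉ = firstᵉ x₂ (call trialᵉ (consᵉ x₃ (consᵉ x₄ (consᵉ x₅ (consᵉ x₂ x₀))) ∷ x₆ ∷ x₇ ∷ []))

opaque
  retryᵉ : Exp 6
  retryᵉ = consᵉ x₀ (call searchᵉ (x₀ ∷ x₁ ∷ x₂ ∷ x₃ ∷ x₄ ∷ x₅ ∷ []))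

opaque
  -- graph, vertices, X, order, the uncolored P
  attemptsᵉ : Exp 5
  -- The accumulator holds the colors of the last attempt and its result.
  attemptsᵉ = tlᵉ (fold (consᵉ nilᵉ nilᵉ) (consᵉ nilᵉ x₂)
    (ifᵉ (tlᵉ x₁) x₁
      (call retryᵉ (consᵉ (consᵉ nilᵉ (hdᵉ (hdᵉ x₁))) (hdᵉ x₁) ∷ x₂ ∷ x₃ ∷ x₄ ∷ x₅ ∷ x₆ ∷ []))))

opaque
  -- The rows of the adjacency matrix only serve as a counter. The list built so far starts with its
  -- largest entry, so the next vertex is the successor of its head.
  verticesOfᵉ : Exp 1
  verticesOfᵉ = fold nilᵉ x₀ (consᵉ (ifᵉ x₁ (consᵉ nilᵉ (hdᵉ x₁)) nilᵉ) x₁)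

opaque
  -- vertices, characteristic list of X
  specialOfᵉ orderOfᵉ : Exp 2
  specialOfᵉ = fold nilᵉ x₀ (ifᵉ (nthᵉ x₃ x₀) (consᵉ x₀ x₁) x₁)
  orderOfᵉ = fold (fold nilᵉ x₀ (ifᵉ (nthᵉ x₃ x₀) x₁ (consᵉ x₀ x₁))) x₀ (ifᵉ (nthᵉ x₃ x₀) (consᵉ x₀ x₁) x₁)

opaque
  uncoloredᵉ : Exp 1
  uncoloredᵉ = fold nilᵉ x₀ (consᵉ nilᵉ x₁)

opaque
  -- graph, vertices, characteristic list of X
  solveᵉ : Exp 3
  solveᵉ = call attemptsᵉ
    (x₀ ∷ x₁ ∷ call specialOfᵉ (x₁ ∷ x₂ ∷ []) ∷ call orderOfᵉ (x₁ ∷ x₂ ∷ []) ∷ call uncoloredᵉ (x₁ ∷ []) ∷ [])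

opaque
  mainᵉ : Exp 1
  mainᵉ = call solveᵉ (hdᵉ x₀ ∷ call verticesOfᵉ (hdᵉ x₀ ∷ []) ∷ tlᵉ x₀ ∷ [])

encodeList-map : ∀ {A B : Set} (enc : B → Tree) (f : A → B) xs → encodeList enc (map f xs) ≡ encodeList (enc ∘ f) xs
encodeList-map enc f []       = refl
encodeList-map enc f (x ∷ xs) = cong (cons (enc (f x))) (encodeList-map enc f xs)

toList-lookup : ∀ {n} {A : Set} (xs : Vec A n) → Vec.toList xs ≡ tabulate (lookup xs)
toList-lookup []       = refl
toList-lookup (x ∷ xs) = cong (x ∷_) (toList-lookup xs)

-- Correctness of the search

module Execution {n : ℕ} (G : Graph n) (X : Subset n) (M : ℕ) (n≤M : n ≤ M) where
  open Special G X
  open Evaluation M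
  open Combinators M
  open Neighborhoods G
  open Tables using (instanceTree)

  private
    d = length special

  SolutionWith : ℕ → PartialColoring n → Set
  SolutionWith q P = (∀ u → P u ≤ q) × (∀ v → Happy (0 ∷ colors q) P v)

  encodeVertices : List (Fin n) → Tree
  encodeVertices = encodeList encodeFin

  uncolored : Tree
  uncolored = encodePartial {n} (const 0)

  inputs : Vec Tree 5
  inputs = encodeGraph G ∷ encodeVertices (vertices n) ∷
           encodeVertices special ∷ encodeVertices order ∷ uncolored ∷ []

  vertices≤M : length (vertices n) ≤ M
  vertices≤M = ℕ.≤-trans (ℕ.≤-reflexive (length-vertices n)) n≤M

  module _ (colors≤M : suc (suc d) ≤ M) (order≤M : length order ≤ M) (table≤M : 2 ^ (d * (suc d * 3)) ≤ M) where

    opaque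
      unfolding searchᵉ

      search-⇓ : Fin n → ∀ q → q ≤ suc d →
        ∃[ r ] (encodeList encodeℕ (colors q) ∷ inputs) ⊢ searchᵉ ⇓ encodeMaybe encodePartial r ×
               Outcome (¬ HasTarget q) (SolutionWith q) r
      search-⇓ v₀ q q≤ =
        let r , run , outcome = first-⇓ encodeFin encodePartial (encodePartial-nonempty v₀)
              {A = SolutionWith q} {F = λ w → ¬ HasTargetAt q w}
              (var _) vertices≤M
              (λ {w} _ →
                let r , run , outcome = Trials.trial-⇓ G special q w M n≤M special≤M q<M (short w)
                                          (order-ordered q w) ∈-order order≤M
                in r , call (consᵉ (var _) (consᵉ (var _) (consᵉ (var _) (consᵉ (var _) (var _)))) ∷
                             var _ ∷ var _ ∷ []) run , outcome)
        in r , run , finish r outcome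
        where
        special≤M : d ≤ M
        special≤M = ℕ.≤-trans (ℕ.m≤n+m d 2) colors≤M
        q<M : suc q ≤ M
        q<M = ℕ.≤-trans (s≤s q≤) colors≤M
        short : ∀ w {L} → Tables.Distinct G special q w L → length L ≤ M
        short w distinct = ℕ.≤-trans (TableSize.distinct-length G special q w distinct)
          (ℕ.≤-trans (ℕ.^-monoʳ-≤ 2 (ℕ.*-monoʳ-≤ d (ℕ.*-monoˡ-≤ 3 q≤))) table≤M)
        finish : ∀ r → Outcome (∀ {w} → w ∈ vertices n →
            ¬ HasTargetAt q w) (SolutionWith q) r →
          Outcome (¬ HasTarget q) (SolutionWith q) r
        finish (just P) solution = solution
        finish nothing none (w , center , target) = none (∈-vertices w) (center , target)

    -- The attempts start at q = 1, so `j = 0` is excluded: a graph with a single vertex has a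
    -- target at 0.
    Minimal : ℕ → Set
    Minimal q = ∀ j → 1 ≤ j → HasTarget j → q ≤ j

    State : Set
    State = ℕ × Maybe (PartialColoring n)

    encodeState : State → Tree
    encodeState (q , r) = cons (encodeList encodeℕ (colors q)) (encodeMaybe encodePartial r)

    Progress : List Tree → State → Set
    Progress ys (q , nothing) = q + length ys ≡ suc d × (∀ j → 1 ≤ j → j ≤ q → ¬ HasTarget j)
    Progress ys (q , just P)  = SolutionWith q P × Minimal q

    opaque
      unfolding retryᵉ

      retry-⇓ : Fin n → ∀ {q ys} → suc q + length ys ≡ suc d → (∀ j → 1 ≤ j → j ≤ q → ¬ HasTarget j) →
        ∃[ s ] (encodeList encodeℕ (colors (suc q)) ∷ inputs) ⊢ retryᵉ ⇓ encodeState s × Progress ys s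
      retry-⇓ v₀ {q} {ys} total none =
        let r , run , outcome = search-⇓ v₀ (suc q) (ℕ.≤-trans (ℕ.m≤m+n (suc q) (length ys)) (ℕ.≤-reflexive total))
        in (suc q , r) , consᵉ (var _) (call (var _ ∷ var _ ∷ var _ ∷ var _ ∷ var _ ∷ var _ ∷ []) run) ,
           finish r outcome
        where
        finish : ∀ r → Outcome (¬ HasTarget (suc q)) (SolutionWith (suc q)) r → Progress ys (suc q , r)
        finish nothing ¬target = total , λ j 1≤j j≤ target → Sum.[
            (λ { (s≤s j≤q) → none j 1≤j j≤q target }) , (λ { refl → ¬target target }) ]′ (ℕ.m≤n⇒m<n∨m≡n j≤)
        finish (just P) solution = solution , λ j 1≤j target → ℕ.≰⇒> λ j≤q → none j 1≤j j≤q target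

    opaque
      unfolding attemptsᵉ

      attempts-⇓ : HasTarget (suc d) →
        ∃[ P ] inputs ⊢ attemptsᵉ ⇓ encodePartial P × ∃[ q ] SolutionWith q P × Minimal q
      attempts-⇓ target@(v₀ , _) =
        let s , run , progress = fold-invariant (λ t → t) encodeState Progress
              -- Only the length `suc d` of this list matters: each entry stands for one attempt q =
              -- 1, ..., `suc d`.
              {xs = nil ∷ map encodeFin special} {s₀ = 0 , nothing}
              (consᵉ nilᵉ nilᵉ) counter
              (ℕ.≤-trans (s≤s (ℕ.≤-reflexive (List.length-map encodeFin special)))
                 (ℕ.≤-trans (ℕ.n≤1+n (suc d)) colors≤M))
              (cong suc (List.length-map encodeFin special) , λ { (suc j) _ () })
              (λ {x} {ys} {s} _ progress → next {x} {ys} s progress)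
        in finish s run progress
        where
        counter : inputs ⊢ consᵉ nilᵉ x₂ ⇓ encodeList (λ t → t) (nil ∷ map encodeFin special)
        counter = subst (λ t → inputs ⊢ consᵉ nilᵉ x₂ ⇓ cons nil t)
                    (≡.sym (encodeList-map (λ t → t) encodeFin special)) (consᵉ nilᵉ (var _))

        body : Exp 7
        body = ifᵉ (tlᵉ x₁) x₁
          (call retryᵉ (consᵉ (consᵉ nilᵉ (hdᵉ (hdᵉ x₁))) (hdᵉ x₁) ∷ x₂ ∷ x₃ ∷ x₄ ∷ x₅ ∷ x₆ ∷ []))

        -- The head of `colors q` is the numeral q. This includes q = 0, as the head of `nil` is
        -- `nil`, the numeral 0.
        next-color : ∀ q {ρ : Vec Tree 7} {e} → ρ ⊢ e ⇓ encodeList encodeℕ (colors q) →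
          ρ ⊢ consᵉ (consᵉ nilᵉ (hdᵉ e)) e ⇓ encodeList encodeℕ (colors (suc q))
        next-color zero    r = consᵉ (consᵉ nilᵉ (hdᵉ r)) r
        next-color (suc q) r = consᵉ (consᵉ nilᵉ (hdᵉ r)) r

        next : ∀ {x ys} s → Progress (x ∷ ys) s →
          ∃[ s′ ] (x ∷ encodeState s ∷ inputs) ⊢ body ⇓ encodeState s′ × Progress ys s′
        next (q , just P) progress =
          let _ , _ , eq = encodePartial-nonempty v₀ P
          in (q , just P) , if-cons (tlᵉ (var _)) eq (var _) , progress
        next {ys = ys} (q , nothing) (total , none) =
          let s , run , progress = retry-⇓ v₀ {q} {ys} (≡.trans (≡.sym (ℕ.+-suc q (length ys))) total) none
          in s , if-false (tlᵉ (var _))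
                   (call (next-color q (hdᵉ (var _)) ∷ var _ ∷ var _ ∷ var _ ∷ var _ ∷ var _ ∷ []) run) , progress

        finish : ∀ s → inputs ⊢ fold (consᵉ nilᵉ nilᵉ) (consᵉ nilᵉ x₂) body ⇓ encodeState s → Progress [] s →
          ∃[ P ] inputs ⊢ tlᵉ (fold (consᵉ nilᵉ nilᵉ) (consᵉ nilᵉ x₂) body) ⇓ encodePartial P ×
                 ∃[ q ] SolutionWith q P × Minimal q
        finish (q , just P) run (solution , minimal) = P , tlᵉ run , q , solution , minimal
        -- The list is used up, so all attempts up to `suc d` have failed, against the target known
        -- to exist there.
        finish (q , nothing) run (total , none) =
          ⊥-elim (none (suc d) (s≤s z≤n) (ℕ.≤-reflexive (≡.trans (≡.sym total) (ℕ.+-identityʳ q))) target)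

    opaque
      unfolding verticesOfᵉ

      verticesOf-⇓ : (encodeGraph G ∷ []) ⊢ verticesOfᵉ ⇓ encodeVertices (vertices n)
      verticesOf-⇓ =
        let s , run , total = fold-invariant (encodeList encodeBool) (λ k → encodeList encodeℕ (List.downFrom k))
              (λ ys k → k + length ys ≡ n) {s₀ = 0} nilᵉ (var _)
              (ℕ.≤-trans (ℕ.≤-reflexive (List.length-tabulate (λ u → tabulate (adj G u)))) n≤M)
              (List.length-tabulate (λ u → tabulate (adj G u)))
              (λ {_} {ys} {k} _ total → suc k , next k , ≡.trans (≡.sym (ℕ.+-suc k (length ys))) total)
        in subst (λ t → (encodeGraph G ∷ []) ⊢ _ ⇓ t) (finish (≡.trans (≡.sym (ℕ.+-identityʳ s)) total)) run
        where
        next : ∀ k {x} {ρ : Vec Tree 1} → (x ∷ encodeList encodeℕ (List.downFrom k) ∷ ρ)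
                      ⊢ consᵉ (ifᵉ x₁ (consᵉ nilᵉ (hdᵉ x₁)) nilᵉ) x₁
                      ⇓ encodeList encodeℕ (List.downFrom (suc k))
        next zero    = consᵉ (if-false (var _) nilᵉ) (var _)
        next (suc k) = consᵉ (if-true (var _) (consᵉ nilᵉ (hdᵉ (var _)))) (var _)
        tabulate-toℕ : ∀ {m} (f : ℕ → ℕ) → tabulate {n = m} (f ∘ toℕ) ≡ List.applyUpTo f m
        tabulate-toℕ {zero}  f = refl
        tabulate-toℕ {suc m} f = cong (f 0 ∷_) (tabulate-toℕ (f ∘ suc))
        finish : ∀ {k} → k ≡ n → encodeList encodeℕ (List.downFrom k) ≡ encodeVertices (vertices n)
        finish refl = ≡.trans (cong (encodeList encodeℕ) (≡.sym numbers)) (encodeList-map encodeℕ toℕ (vertices n))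
          where
          open ≡.≡-Reasoning
          numbers : map toℕ (vertices n) ≡ List.downFrom n
          numbers = begin
            map toℕ (reverse (allFin n))   ≡⟨ List.reverse-map toℕ (allFin n) ⟩
            reverse (map toℕ (allFin n))   ≡⟨ cong reverse (List.map-tabulate {n = n} (λ u → u) toℕ) ⟩
            reverse (tabulate {n = n} toℕ) ≡⟨ cong reverse (tabulate-toℕ {n} (λ k → k)) ⟩
            reverse (List.upTo n)          ≡⟨ List.reverse-upTo n ⟩
            List.downFrom n                ∎

    special? : ∀ {k} {ρ : Vec Tree k} {l e v} → ρ ⊢ l ⇓ encodeSubset X → ρ ⊢ e ⇓ encodeFin v →
               ρ ⊢ nthᵉ l e ⇓? (v Subset.∈ X)
    special? {ρ = ρ} {l} rl re = map? T-∈
      (bool? (nth-⇓ encodeBool n≤M (subst (λ t → ρ ⊢ l ⇓ encodeList encodeBool t) (toList-lookup X) rl) re))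
      where
      T-∈ : ∀ {v} → T (lookup X v) ⇔ v Subset.∈ X
      T-∈ {v} = subst (λ Y → T (lookup X v) ⇔ v Subset.∈ Y) (Vec.tabulate∘lookup X) (⇔-sym tabulate-∈)

    -- Reading the vertices in decreasing order and consing restores the increasing order: a left
    -- fold over a reversed list is a right fold over the list.
    collect-⇓ : ∀ {P : Fin n → Set} (P? : ∀ v → Dec (P v)) {k} {ρ : Vec Tree k} {a l b us} →
      ρ ⊢ a ⇓ encodeVertices us → ρ ⊢ l ⇓ encodeVertices (vertices n) →
      (∀ {v vs} → P v → (encodeFin v ∷ encodeVertices vs ∷ ρ) ⊢ b ⇓ encodeVertices (v ∷ vs)) →
      (∀ {v vs} → ¬ P v → (encodeFin v ∷ encodeVertices vs ∷ ρ) ⊢ b ⇓ encodeVertices vs) →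
      ρ ⊢ fold a l b ⇓ encodeVertices (List.filter P? (allFin n) List.++ us)
    collect-⇓ P? {ρ = ρ} {a} {l} {b} {us} ra rl keep omit =
      let s , run , eq = fold-invariant encodeFin encodeVertices
            (λ vs s → foldl add s vs ≡ List.filter P? (allFin n) List.++ us) ra rl vertices≤M
            (≡.trans (List.reverse-foldl add us (allFin n)) (foldr-filter (allFin n)))
            (λ {v} {_} {s} _ eq → add s v , step′ v s , eq)
      in subst (λ s → ρ ⊢ fold a l b ⇓ encodeVertices s) eq run
      where
      add : List (Fin n) → Fin n → List (Fin n)
      add s v with P? v
      ... | yes _ = v ∷ s
      ... | no _  = s
      step′ : ∀ v s → (encodeFin v ∷ encodeVertices s ∷ ρ) ⊢ b ⇓ encodeVertices (add s v)
      step′ v s with P? v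
      ... | yes p = keep p
      ... | no ¬p = omit ¬p
      foldr-filter : ∀ vs → List.foldr (λ v s → add s v) us vs ≡ List.filter P? vs List.++ us
      foldr-filter [] = refl
      foldr-filter (v ∷ vs) with P? v
      ... | yes _ = cong (v ∷_) (foldr-filter vs)
      ... | no _  = foldr-filter vs

    if-⇓ : ∀ {k} {ρ : Vec Tree k} {b d e x} {A : Set} → ρ ⊢ b ⇓? A →
           (A → ρ ⊢ d ⇓ x) → (¬ A → ρ ⊢ e ⇓ x) → ρ ⊢ ifᵉ b d e ⇓ x
    if-⇓ (holds r a)  f g = if-true r (f a)
    if-⇓ (fails r ¬a) f g = if-false r (g ¬a)

    opaque
      unfolding specialOfᵉ orderOfᵉ

      -- The initial value `a` is arbitrary because the same loop serves twice: started from `nil`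
      -- it lists X, started from the other vertices it puts X in front of them.
      collectSpecial-⇓ : ∀ {a us} (let ρ = encodeVertices (vertices n) ∷ encodeSubset X ∷ []) →
        ρ ⊢ a ⇓ encodeVertices us →
        ρ ⊢ fold a x₀ (ifᵉ (nthᵉ x₃ x₀) (consᵉ x₀ x₁) x₁) ⇓ encodeVertices (special List.++ us)
      collectSpecial-⇓ ra = collect-⇓ (Subset._∈? X) ra (var _)
        (λ p → if-⇓ (special? (var _) (var _)) (λ _ → consᵉ (var _) (var _)) (λ ¬p → ⊥-elim (¬p p)))
        (λ ¬p → if-⇓ (special? (var _) (var _)) (λ p → ⊥-elim (¬p p)) (λ _ → var _))

      specialOf-⇓ : (encodeVertices (vertices n) ∷ encodeSubset X ∷ []) ⊢ specialOfᵉ ⇓ encodeVertices special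
      specialOf-⇓ = subst
        (λ us → (encodeVertices (vertices n) ∷ encodeSubset X ∷ []) ⊢ specialOfᵉ ⇓ encodeVertices us)
        (List.++-identityʳ special) (collectSpecial-⇓ {us = []} nilᵉ)

      orderOf-⇓ : (encodeVertices (vertices n) ∷ encodeSubset X ∷ []) ⊢ orderOfᵉ ⇓ encodeVertices order
      orderOf-⇓ = collectSpecial-⇓ (subst
        (λ us → (encodeVertices (vertices n) ∷ encodeSubset X ∷ []) ⊢ _ ⇓ encodeVertices us)
        (List.++-identityʳ regular)
        (collect-⇓ (λ v → ¬? (v Subset.∈? X)) {us = []} nilᵉ (var _)
          (λ ¬p → if-⇓ (special? (var _) (var _)) (λ p → ⊥-elim (¬p p)) (λ _ → consᵉ (var _) (var _)))
          (λ ¬¬p → if-⇓ (special? (var _) (var _)) (λ _ → var _) (λ ¬p → ⊥-elim (¬¬p ¬p)))))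

    opaque
      unfolding uncoloredᵉ

      uncolored-⇓ : (encodeVertices (vertices n) ∷ []) ⊢ uncoloredᵉ ⇓ uncolored
      uncolored-⇓ = tabulate-⇓ encodeℕ n≤M (var _) nilᵉ

    opaque
      unfolding solveᵉ mainᵉ

      main-⇓ : HasTarget (suc d) →
        ∃[ P ] (cons (encodeGraph G) (encodeSubset X) ∷ []) ⊢ mainᵉ ⇓ encodePartial P ×
               ∃[ q ] SolutionWith q P × Minimal q
      main-⇓ target =
        let P , run , result = attempts-⇓ target
        in P , call (hdᵉ (var _) ∷ call (hdᵉ (var _) ∷ []) verticesOf-⇓ ∷ tlᵉ (var _) ∷ [])
                 (call (var _ ∷ var _ ∷ call (var _ ∷ var _ ∷ []) specialOf-⇓ ∷ call (var _ ∷ var _ ∷ []) orderOf-⇓ ∷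
                        call (var _ ∷ []) uncolored-⇓ ∷ []) run) , result

-- The running time

numeral : ℕ → Program
numeral zero    = `nil
numeral (suc c) = `cons `nil (numeral c)

computable-const : ∀ c → Computable (λ _ → c)
computable-const c = numeral c , λ d → run c
  where
  run : ∀ c {x} → ∃[ t ] numeral c ∶ x ⇓ encodeℕ c ⟨ t ⟩
  run zero    = 1 , `nil
  run (suc c) = let t , r = run c in _ , `cons `nil r

computable-id : Computable (λ d → d)
computable-id = skip , λ d → 1 , skip

-- `Computable` asks for termination without a time bound, so the length bound M may be chosen
-- separately for every pair of inputs.
computable-op : ∀ {op : ℕ → ℕ → ℕ} (e : Exp 2) →
  (∀ a b → ∃[ M ] Evaluation._⊢_⇓_ M (encodeℕ a ∷ encodeℕ b ∷ []) e (encodeℕ (op a b))) →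
  ∀ {f g} → Computable f → Computable g → Computable (λ d → op (f d) (g d))
computable-op e correct {f} {g} (p , run-p) (p′ , run-p′) = `cons p (`cons p′ `nil) ⨾ compile e , λ d →
  let _ , r         = run-p d
      _ , r′        = run-p′ d
      M , derivation = correct (f d) (g d)
      _ , r″ , _    = Compilation.compile-correct M derivation
  in _ , `cons r (`cons r′ `nil) ⨾ r″

addᵉ multiplyᵉ exp2ᵉ : Exp 2
addᵉ      = fold x₁ x₀ (consᵉ nilᵉ x₁)
multiplyᵉ = fold nilᵉ x₀ (fold x₁ x₃ (consᵉ nilᵉ x₁))
exp2ᵉ     = fold (consᵉ nilᵉ nilᵉ) x₀ (fold x₁ x₁ (consᵉ nilᵉ x₁))

module Arithmetic (M : ℕ) where
  open Evaluation M

  len-≤ : ∀ {a} → a ≤ M → len (encodeℕ a) ≤ M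
  len-≤ {a} a≤ = ℕ.≤-trans (ℕ.≤-reflexive (len-encodeℕ a)) a≤

  loop-≡ : ∀ {k} {ρ : Vec Tree k} {b s xs c c′} → c ≡ c′ →
           Loop ρ b s xs (encodeℕ c) → Loop ρ b s xs (encodeℕ c′)
  loop-≡ refl r = r

  add-loop : ∀ {k} {ρ : Vec Tree k} a b → Loop ρ (consᵉ nilᵉ x₁) (encodeℕ b) (encodeℕ a) (encodeℕ (a + b))
  add-loop zero    b = stop
  add-loop (suc a) b = step (consᵉ nilᵉ (var _))
    (loop-≡ (ℕ.+-suc a b) (add-loop a (suc b)))

  add-⇓ : ∀ a b → a ≤ M → (encodeℕ a ∷ encodeℕ b ∷ []) ⊢ addᵉ ⇓ encodeℕ (a + b)
  add-⇓ a b a≤ = fold (var _) (var _) (len-≤ a≤) (add-loop a b)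

  multiply-⇓ : ∀ a b → a ≤ M → b ≤ M → (encodeℕ a ∷ encodeℕ b ∷ []) ⊢ multiplyᵉ ⇓ encodeℕ (a * b)
  multiply-⇓ a b a≤ b≤ = fold nilᵉ (var _) (len-≤ a≤)
    (loop-≡ (ℕ.+-identityʳ (a * b)) (run a 0))
    where
    run : ∀ k s → Loop (encodeℕ a ∷ encodeℕ b ∷ []) (fold x₁ x₃ (consᵉ nilᵉ x₁))
                       (encodeℕ s) (encodeℕ k) (encodeℕ (k * b + s))
    run zero    s = stop
    run (suc k) s = step (fold (var _) (var _) (len-≤ b≤) (add-loop b s))
      (loop-≡ (shuffle k) (run k (b + s)))
      where
      shuffle : ∀ k → k * b + (b + s) ≡ suc k * b + s
      shuffle k = ≡.trans (≡.sym (ℕ.+-assoc (k * b) b s)) (cong (_+ s) (ℕ.+-comm (k * b) b))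

  -- Each round doubles the accumulator by folding over it, so the accumulator has to stay within M.
  -- The inner `run` keeps `2 ^ k * s` constant, where k rounds remain and s is the current value.
  exp2-⇓ : ∀ a b → a ≤ M → 2 ^ a ≤ M → (encodeℕ a ∷ encodeℕ b ∷ []) ⊢ exp2ᵉ ⇓ encodeℕ (2 ^ a)
  exp2-⇓ a b a≤ 2^a≤ = fold (consᵉ nilᵉ nilᵉ) (var _) (len-≤ a≤)
    (loop-≡ (ℕ.*-identityʳ (2 ^ a))
      (run a 1 (ℕ.≤-trans (ℕ.≤-reflexive (ℕ.*-identityʳ (2 ^ a))) 2^a≤)))
    where
    run : ∀ k s → 2 ^ k * s ≤ M → Loop (encodeℕ a ∷ encodeℕ b ∷ []) (fold x₁ x₁ (consᵉ nilᵉ x₁))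
                                       (encodeℕ s) (encodeℕ k) (encodeℕ (2 ^ k * s))
    run zero    s _ = loop-≡ (≡.sym (ℕ.+-identityʳ s)) stop
    run (suc k) s s≤ = step (fold (var _) (var _) (len-≤ small) (add-loop s s))
      (loop-≡ double
        (run k (s + s) (ℕ.≤-trans (ℕ.≤-reflexive double) s≤)))
      where
      double : 2 ^ k * (s + s) ≡ 2 ^ suc k * s
      double = solve 2 (λ p s → p :* (s :+ s) := (con 2 :* p) :* s) refl (2 ^ k) s
        where open +-*-Solver
      small : s ≤ M
      small = ℕ.≤-trans (ℕ.m≤n*m s (2 ^ suc k) {{ℕ.m^n≢0 2 (suc k)}}) s≤

computable-+ : ∀ {f g} → Computable f → Computable g → Computable (λ d → f d + g d)
computable-+ = computable-op addᵉ λ a b → a , Arithmetic.add-⇓ a a b ℕ.≤-refl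

computable-* : ∀ {f g} → Computable f → Computable g → Computable (λ d → f d * g d)
computable-* = computable-op multiplyᵉ λ a b →
  a + b , Arithmetic.multiply-⇓ (a + b) a b (ℕ.m≤m+n a b) (ℕ.m≤n+m b a)

computable-2^ : ∀ {f} → Computable f → Computable (λ d → 2 ^ f d)
computable-2^ p = computable-op {λ a _ → 2 ^ a} exp2ᵉ
  (λ a b → a + 2 ^ a , Arithmetic.exp2-⇓ (a + 2 ^ a) a b (ℕ.m≤m+n a _) (ℕ.m≤n+m _ a)) p (computable-const 0)

computable-^ : ∀ {f} → Computable f → ∀ e → Computable (λ d → f d ^ e)
computable-^ p zero    = computable-const 1
computable-^ p (suc e) = computable-* p (computable-^ p e)

*-^-distrib : ∀ a b e → (a * b) ^ e ≡ a ^ e * b ^ e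
*-^-distrib a b zero    = refl
*-^-distrib a b (suc e) =
  ≡.trans (cong (a * b *_) (*-^-distrib a b e)) (ℕ.[m*n]*[o*p]≡[m*o]*[n*p] a b (a ^ e) (b ^ e))

-- The prefix turns the input into an environment with one entry. It takes 3 steps, and the
-- composition one more; these are the 4 steps in `runtime-poly`.
algorithm : Program
algorithm = `cons skip `nil ⨾ compile mainᵉ

runtime-poly : Poly (λ M → 4 + bound mainᵉ M)
runtime-poly = poly-+ (poly-const 4) (bound-poly mainᵉ)

coefficient exponent : ℕ
coefficient = proj₁ runtime-poly
exponent    = proj₁ (proj₂ runtime-poly)

Fin-nonZero : ∀ {n} → Fin n → NonZero n
Fin-nonZero {suc _} _ = _

-- n * listBound d bounds the length of every list that the algorithm traverses.
tableBound listBound : ℕ → ℕ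
tableBound d = 2 ^ (d * (suc d * 3))
listBound d = tableBound d + (d + 2)

runtime : ℕ → ℕ
runtime d = coefficient * suc (listBound d) ^ exponent

runtime-computable : Computable runtime
runtime-computable = computable-* (computable-const coefficient) (computable-^
  (computable-+ (computable-const 1) (computable-+
    (computable-2^ (computable-* computable-id
      (computable-* (computable-+ (computable-const 1) computable-id) (computable-const 3))))
    (computable-+ computable-id (computable-const 2)))) exponent)

-- The bounds on the steps and on the number of colors

module _ {n : ℕ} (G : Graph n) (X : Subset n) (t : Threshold G (∁ X)) where
  open Special G X
  open Neighborhoods G
  open ConflictFree G

  private
    d M : ℕ
    d = length special
    M = n * listBound d
    vertex : Fin n
    vertex = proj₁ (center-exists 0 t)

  listBound≤M : listBound d ≤ M
  listBound≤M = ℕ.m≤n*m (listBound d) n {{Fin-nonZero vertex}}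

  two≤listBound : 2 ≤ listBound d
  two≤listBound = ℕ.≤-trans (ℕ.m≤n+m 2 d) (ℕ.m≤n+m (d + 2) (tableBound d))

  double≤M : n * 2 ≤ M
  double≤M = ℕ.*-monoʳ-≤ n two≤listBound

  n≤M : n ≤ M
  n≤M = ℕ.≤-trans (ℕ.m≤m*n n 2) double≤M

  colors≤M : suc (suc d) ≤ M
  colors≤M = ℕ.≤-trans (ℕ.≤-trans (ℕ.≤-reflexive (ℕ.+-comm 2 d)) (ℕ.m≤n+m (d + 2) (tableBound d))) listBound≤M

  table≤M : 2 ^ (d * (suc d * 3)) ≤ M
  table≤M = ℕ.≤-trans (ℕ.m≤m+n _ (d + 2)) listBound≤M

  -- Each of the two filtered lists has at most n entries, and the crude bound n + n is below M
  -- because `listBound d` is at least 2.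
  order≤M : length order ≤ M
  order≤M = ℕ.≤-trans (begin
    length order                        ≡⟨ List.length-++ special ⟩
    length special + length regular     ≤⟨ ℕ.+-mono-≤ filtered filtered ⟩
    n + n                               ≡⟨ solve 1 (λ n → n :+ n := n :* con 2) refl n ⟩
    n * 2                               ∎) double≤M
    where
    open ℕ.≤-Reasoning
    open +-*-Solver
    filtered : ∀ {Q : Fin n → Set} {Q? : ∀ v → Dec (Q v)} → length (List.filter Q? (allFin n)) ≤ n
    filtered {Q? = Q?} = ℕ.≤-trans (List.length-filter Q? (allFin n)) (ℕ.≤-reflexive (length-allFin n))

  -- M is the product of n and a function of d, so its power is a product of a power of n and a
  -- function of d.
  runtime-≤ : 4 + bound mainᵉ M ≤ runtime ∣ X ∣ * n ^ exponent
  runtime-≤ = begin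
    4 + bound mainᵉ M
      ≤⟨ proj₂ (proj₂ runtime-poly) M ⟩
    coefficient * suc M ^ exponent
      ≤⟨ ℕ.*-monoʳ-≤ coefficient (ℕ.^-monoˡ-≤ exponent suc-M) ⟩
    coefficient * (suc (listBound d) * n) ^ exponent
      ≡⟨ cong (coefficient *_) (*-^-distrib (suc (listBound d)) n exponent) ⟩
    coefficient * (suc (listBound d) ^ exponent * n ^ exponent)
      ≡⟨ ℕ.*-assoc coefficient (suc (listBound d) ^ exponent) (n ^ exponent) ⟨
    runtime d * n ^ exponent
      ≡⟨ cong (λ d → runtime d * n ^ exponent) length-special ⟩
    runtime ∣ X ∣ * n ^ exponent ∎
    where
    open ℕ.≤-Reasoning
    -- There is at least one vertex, so the successor is absorbed by one more summand n.
    suc-M : suc M ≤ suc (listBound d) * n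
    suc-M = ℕ.+-mono-≤ (>-nonZero⁻¹ n {{Fin-nonZero vertex}}) (ℕ.≤-reflexive (ℕ.*-comm n (listBound d)))

  module _ {P : PartialColoring n} {q : ℕ} (bounded : ∀ u → P u ≤ q)
           (happy : ∀ v → Happy (0 ∷ colors q) P v) where

    coloring : Coloring n (suc q)
    coloring u = fromℕ< (s≤s (bounded u))

    encodeColoring-coloring : encodeColoring coloring ≡ encodePartial P
    encodeColoring-coloring = cong (encodeList encodeℕ) (List.tabulate-cong λ u → Fin.toℕ-fromℕ< (s≤s (bounded u)))

    coloring-conflictFree : IsCFCN G coloring
    coloring-conflictFree = Equivalence.from cfcn λ v →
      let a , a∈ , u , (m , p) , only = find (happy v)
          a< = s≤s (color≤ a∈)
      in fromℕ< a< , u , (m , Fin.fromℕ<-cong _ _ p _ _) , λ z (m′ , p′) → only z (m′ , recover a< p′)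
      where
      color≤ : ∀ {a} → a ∈ 0 ∷ colors q → a ≤ q
      color≤ (here refl) = z≤n
      color≤ (there a∈)  = colors-≤ a∈
      recover : ∀ {a z} (a< : a < suc q) → coloring z ≡ fromℕ< a< → P z ≡ a
      recover {z = z} a< eq = ≡.trans (≡.sym (Fin.toℕ-fromℕ< (s≤s (bounded z))))
        (≡.trans (cong toℕ eq) (Fin.toℕ-fromℕ< a<))

  solve : Σ[ k ∈ ℕ ] Σ[ C ∈ Coloring n k ] Σ[ s ∈ ℕ ] Σ[ χ ∈ ℕ ]
    (algorithm ∶ cons (encodeGraph G) (encodeSubset X) ⇓ encodeColoring C ⟨ s ⟩
    × s ≤ runtime ∣ X ∣ * n ^ exponent
    × IsCFCN G C × χcf[ G ]≡ χ × χ ≤ k × k ≤ suc χ)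
  solve =
    let P , derivation , q , (bounded , happy) , minimal =
          Execution.main-⇓ G X M n≤M colors≤M order≤M table≤M (default-target t)
        s , run , s≤ = Compilation.compile-correct M derivation
        χ , χ-least@(colorable , least-χ) = χ-exists
        conflict-free = coloring-conflictFree {P} bounded happy
        C = coloring {P} bounded happy
    -- The colors are 0, ..., q; the additional one is the color 0 of `w`, so that q ≤ χ gives the
    -- upper bound.
    in suc q , C , 4 + s , χ ,
       output-≡ (≡.sym (encodeColoring-coloring {P} bounded happy)) (`cons skip `nil ⨾ run) ,
       ℕ.≤-trans (ℕ.+-monoʳ-≤ 4 s≤) runtime-≤ ,
       conflict-free , χ-least , least-χ (suc q) (C , conflict-free) , s≤s (q≤χ minimal colorable)
    where
    output-≡ : ∀ {p x y z s} → y ≡ z → p ∶ x ⇓ y ⟨ s ⟩ → p ∶ x ⇓ z ⟨ s ⟩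
    output-≡ refl r = r
    q≤χ : ∀ {q χ} → (∀ j → 1 ≤ j → HasTarget j → q ≤ j) → CFCNColorable G χ → q ≤ χ
    -- A graph with a vertex has no coloring with 0 colors, so χ is at least 1 and within reach of
    -- the minimality of q.
    q≤χ {χ = zero} _ (C , _) with () ← C vertex
    q≤χ {χ = suc χ} minimal colorable = minimal (suc χ) (s≤s z≤n) (coloring-target t colorable)

theorem2 : Σ[ f ∈ (ℕ → ℕ) ] Computable f ×
    (Σ[ algorithm ∈ Program ] Σ[ e ∈ ℕ ]
    (∀ (n : ℕ) (G : Graph n) (X : Subset n) →
    Connected G →
    Threshold G (∁ X) →
    Σ[ k ∈ ℕ ] Σ[ C ∈ Coloring n k ] Σ[ t ∈ ℕ ] Σ[ χ ∈ ℕ ]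
    (algorithm ∶ cons (encodeGraph G) (encodeSubset X) ⇓ encodeColoring C ⟨ t ⟩
    × t ≤ f ∣ X ∣ * n ^ e
    × IsCFCN G C
    × χcf[ G ]≡ χ
    × χ ≤ k
    × k ≤ suc χ)))
theorem2 = runtime , runtime-computable , algorithm , exponent , λ n G X _ t → solve G X t
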